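{- For every Boolean Continuous Algebra $A$, the order on $Sp(A)$ is the equality.
   Context: A Boolean Continuous Algebra (BC-algebra) is an algebra $USC(\mathcal B)$, $\mathcal B$ a complete Boolean algebra (least $\bot$, greatest $\top$), where $USC(\mathcal B)$ is the set of maps $f:[0,1]\to\mathcal B$ preserving arbitrary suprema (so $f(0)=\bot$), ordered by $f\le g\iff g(q)\le f(q)$ for all $q$; $\vee,\wedge$ are join and meet for this order; $(f\dot+g)(q)=\bigvee\{f(p)\wedge g(r):p,r\in[0,1],\ p+r<q\}$ (meet in $\mathcal B$); for $c\in[0,1]$ the constant $\underline c$ is the map with $\underline c(q)=\top$ if $q>c$ and $\bot$ otherwise; $(\frac f2)(q)=f(2q)$ if $q\le\frac12$ and $\top$ if $q>\frac12$; $j(f)(q)=f(\frac{1+q}2)$ if $q>0$ and $\bot$ if $q=0$; and $f\odot g=j(\frac f2\dot+\frac g2)$. An ordered topological space $(X,\le)$ is Hausdorff if $\le$ is closed in $X^2$; $C^0_\nearrow(X)$ is the set of continuous non-decreasing functions $X\to[0,1]$, with pointwise order, $\vee$, $\wedge$, $x\dot+y=\min(x+y,1)$, $x\odot y=\max(x+y-1,0)$ and constants $c\in[0,1]$. By a known duality (Abbadini), for each BC-algebra $A$ (which is in particular a Cauchy-complete Archimedean MC-algebra) there is a compact Hausdorff ordered topological space $Sp(A)$, unique up to isomorphism of ordered topological spaces, such that $A\cong C^0_\nearrow(Sp(A))$ for the operations $\vee,\wedge,\dot+,\odot$ and the constants. -}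

module Defs where

open import Algebra.Core using (Op₂)
open import Axiom.ExcludedMiddle using (ExcludedMiddle)
open import Data.Empty using (⊥-elim)
open import Data.Integer.Base as ℤ using (ℤ; +_; -[1+_]; ∣_∣)
open import Data.List.Base using (List)
open import Data.List.Relation.Unary.Any using (Any)
open import Data.Nat.Base as ℕ using (ℕ; zero; suc)
import Data.Nat.Properties as ℕ
import Data.Integer.Properties as ℤ
open import Data.Product.Base using (Σ; ∃; ∃₂; _×_; _,_; proj₁; proj₂)
open import Data.Product.Relation.Binary.Pointwise.NonDependent using (×-setoid)
open import Data.Rational.Base as ℚ using (ℚ; 0ℚ; 1ℚ; ½)
import Data.Rational.Properties as ℚ
import Data.Rational.Unnormalised.Base as ℚᵘ
import Data.Rational.Unnormalised.Properties as ℚᵘ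
open import Data.Rational.Solver using (module +-*-Solver)
open import Data.Sum.Base using (_⊎_; inj₁; inj₂; [_,_]′)
open import Data.Unit.Polymorphic using (tt)
open import Function.Base using (_∘_)
open import Function.Bundles using (Bijection)
open import Level using (Level; Lift; lift; lower; 0ℓ; _⊔_) renaming (suc to lsuc)
open import Relation.Binary using (Rel; Setoid; Poset; IsEquivalence; _Respects_)
open import Relation.Binary.Lattice using (BooleanAlgebra; Supremum; Infimum)
open import Relation.Binary.PropositionalEquality
  using (_≡_; refl; sym; trans; cong; subst; subst₂)
open import Relation.Nullary using (¬_; yes; no)
open import Relation.Unary using (Pred; _∈_; _∉_; _⊆_; _≐_; _∩_; _∪_; ∁; ⋃; _⊢_; _⟨×⟩_)
open import Relation.Unary.Polymorphic using (U)
import Algebra.Morphism.Definitions as Morphism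
import Relation.Binary.Lattice.Properties.HeytingAlgebra as HeytingAlgebraProperties
import Relation.Binary.Lattice.Properties.MeetSemilattice as MeetSemilatticeProperties

private
  variable
    a b e ℓ o : Level

private
  1ℓ : Level
  1ℓ = lsuc 0ℓ

module Rational where

  double-½ : ∀ q → q ℚ.* ½ ℚ.+ q ℚ.* ½ ≡ q
  double-½ q = trans (sym (ℚ.*-distribˡ-+ q ½ ½)) (ℚ.*-identityʳ q)

  p-1<p : ∀ p → p ℚ.- 1ℚ ℚ.< p
  p-1<p p = subst (p ℚ.- 1ℚ ℚ.<_) (ℚ.+-identityʳ p)
    (ℚ.+-monoʳ-< p (ℚ.negative⁻¹ (ℚ.- 1ℚ)))

  p<p+1 : ∀ p → p ℚ.< p ℚ.+ 1ℚ
  p<p+1 p = subst (ℚ._< p ℚ.+ 1ℚ) (ℚ.+-identityʳ p)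
    (ℚ.+-monoʳ-< p (ℚ.positive⁻¹ 1ℚ))

  a-b+b : ∀ x y → x ℚ.- y ℚ.+ y ≡ x
  a-b+b = solve 2 (λ x y → x :- y :+ y := x) refl where open +-*-Solver

  0<⇒<+ : ∀ {δ} p → 0ℚ ℚ.< δ → p ℚ.< p ℚ.+ δ
  0<⇒<+ {δ} p h = subst (ℚ._< p ℚ.+ δ) (ℚ.+-identityʳ p) (ℚ.+-monoʳ-< p h)

  <⇒0<- : ∀ {p q} → p ℚ.< q → 0ℚ ℚ.< q ℚ.- p
  <⇒0<- {p} {q} h = subst (ℚ._< q ℚ.- p) (ℚ.+-inverseʳ p) (ℚ.+-monoˡ-< (ℚ.- p) h)

  half-< : ∀ {q r} → q ℚ.+ q ℚ.< r → q ℚ.< r ℚ.* ½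
  half-< {q} {r} h with q ℚ.<? r ℚ.* ½
  ... | yes p = p
  ... | no p = ⊥-elim (ℚ.<-irrefl refl (ℚ.<-≤-trans h
          (subst (ℚ._≤ q ℚ.+ q) (double-½ r) (ℚ.+-mono-≤ (ℚ.≮⇒≥ p) (ℚ.≮⇒≥ p)))))

  infixl 7 _·_
  _·_ : ℕ → ℚ → ℚ
  zero  · p = 0ℚ
  suc n · p = n · p ℚ.+ p

  ·-* : ∀ n δ → n · δ ≡ n · 1ℚ ℚ.* δ
  ·-* zero    δ = sym (ℚ.*-zeroˡ δ)
  ·-* (suc n) δ = trans (cong (ℚ._+ δ) (·-* n δ))
    (solve 2 (λ x y → x :* y :+ y := (x :+ con 1ℚ) :* y) refl (n · 1ℚ) δ)
    where open +-*-Solver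

  ·1-toℚᵘ : ∀ n → ℚ.toℚᵘ (n · 1ℚ) ℚᵘ.≃ ℚᵘ.mkℚᵘ (+ n) 0
  ·1-toℚᵘ zero    = ℚᵘ.≃-refl
  ·1-toℚᵘ (suc n) = ℚᵘ.≃-trans (ℚ.toℚᵘ-homo-+ (n · 1ℚ) 1ℚ)
    (ℚᵘ.≃-trans (ℚᵘ.+-congˡ ℚᵘ.1ℚᵘ (·1-toℚᵘ n))
      (ℚᵘ.*≡* (cong (ℤ._* + 1) (trans (cong (ℤ._+ + 1) (ℤ.*-identityʳ (+ n)))
        (cong +_ (ℕ.+-comm n 1))))))

  ≤-·1 : ∀ s → s ℚ.≤ ∣ ℚ.↥ s ∣ · 1ℚ
  ≤-·1 s@(ℚ.mkℚ n d _) = ℚ.toℚᵘ-cancel-≤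
    (ℚᵘ.≤-respʳ-≃ (ℚᵘ.≃-sym (·1-toℚᵘ ∣ n ∣)) (ℚᵘ.*≤* (bound n)))
    where
    bound : ∀ n → n ℤ.* + 1 ℤ.≤ + ∣ n ∣ ℤ.* + suc d
    bound (+ k)    = ℤ.*-monoˡ-≤-nonNeg (+ k) (ℤ.+≤+ (ℕ.s≤s ℕ.z≤n))
    bound -[1+ k ] = ℤ.-≤+

  archimedean : ∀ r {δ} → 0ℚ ℚ.< δ → ∃ λ n → r ℚ.≤ n · δ
  archimedean r {δ} 0<δ = n , subst₂ ℚ._≤_ r/δ*δ (sym (·-* n δ))
                                (ℚ.*-monoʳ-≤-nonNeg δ (≤-·1 (r ℚ.* ℚ.1/ δ)))
    where
    instance
      δ-pos : ℚ.Positive δ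
      δ-pos = ℚ.positive 0<δ
      δ-nonZero : ℚ.NonZero δ
      δ-nonZero = ℚ.pos⇒nonZero δ
      δ-nonNeg : ℚ.NonNegative δ
      δ-nonNeg = ℚ.pos⇒nonNeg δ
    n = ∣ ℚ.↥ (r ℚ.* ℚ.1/ δ) ∣
    r/δ*δ : r ℚ.* ℚ.1/ δ ℚ.* δ ≡ r
    r/δ*δ = trans (ℚ.*-assoc r (ℚ.1/ δ) δ)
      (trans (cong (r ℚ.*_) (ℚ.*-inverseˡ δ)) (ℚ.*-identityʳ r))

open Rational

-- Real numbers as lower Dedekind cuts of ℚ; with excluded middle these are the
-- usual reals.

record ℝ : Set₁ where
  field
    cut       : Pred ℚ 0ℓ
    inhabited : ∃ λ q → q ∈ cut
    bounded   : ∃ λ q → q ∉ cut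
    downward  : ∀ {p q} → p ℚ.< q → q ∈ cut → p ∈ cut
    rounded   : ∀ {q} → q ∈ cut → ∃ λ r → q ℚ.< r × r ∈ cut

open ℝ public

module Real where

  infix  4 _≤_ _<_
  infixl 6 _+_
  infixr 6 _∨_
  infixr 7 _∧_

  _≤_ : Rel ℝ 0ℓ
  x ≤ y = cut x ⊆ cut y

  _<_ : Rel ℝ 0ℓ
  x < y = ∃ λ q → q ∉ cut x × q ∈ cut y

  downward-≤ : ∀ x {p q} → p ℚ.≤ q → q ∈ cut x → p ∈ cut x
  downward-≤ x {p} {q} p≤q q∈x with p ℚ.<? q
  ... | yes p<q = downward x p<q q∈x
  ... | no  p≮q = subst (_∈ cut x) (ℚ.≤-antisym (ℚ.≮⇒≥ p≮q) p≤q) q∈x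

  cut-< : ∀ x {p q} → p ∈ cut x → q ∉ cut x → p ℚ.< q
  cut-< x {p} {q} p∈x q∉x with p ℚ.<? q
  ... | yes p<q = p<q
  ... | no  p≮q = ⊥-elim (q∉x (downward-≤ x (ℚ.≮⇒≥ p≮q) p∈x))

  ≤-<-trans : ∀ {x y z} → x ≤ y → y < z → x < z
  ≤-<-trans x≤y (q , q∉y , q∈z) = q , (λ q∈x → q∉y (x≤y q∈x)) , q∈z

  <-≤-trans : ∀ {x y z} → x < y → y ≤ z → x < z
  <-≤-trans x<y y≤z = proj₁ x<y , proj₁ (proj₂ x<y) , y≤z (proj₂ (proj₂ x<y))

  <⇒≤ : ∀ {x y} → x < y → x ≤ y
  <⇒≤ {x} {y} (q , q∉x , q∈y) p∈x = downward y (cut-< x p∈x q∉x) q∈y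

  <⇒≱ : ∀ {x y} → x < y → ¬ y ≤ x
  <⇒≱ (q , q∉x , q∈y) y≤x = q∉x (y≤x q∈y)

  fromℚ : ℚ → ℝ
  fromℚ c = record
    { cut       = ℚ._< c
    ; inhabited = c ℚ.- 1ℚ , p-1<p c
    ; bounded   = c , ℚ.<-irrefl refl
    ; downward  = ℚ.<-trans
    ; rounded   = λ q<c → let r , q<r , r<c = ℚ.<-dense q<c in r , q<r , r<c
    }

  0ℝ 1ℝ -1ℝ : ℝ
  0ℝ  = fromℚ 0ℚ
  1ℝ  = fromℚ 1ℚ
  -1ℝ = fromℚ (ℚ.- 1ℚ)

  ∈⇒fromℚ< : ∀ x {q} → q ∈ cut x → fromℚ q < x
  ∈⇒fromℚ< x {q} q∈x = q , ℚ.<-irrefl refl , q∈x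

  fromℚ<⇒∈ : ∀ x {q} → fromℚ q < x → q ∈ cut x
  fromℚ<⇒∈ x (r , r≮q , r∈x) = downward-≤ x (ℚ.≮⇒≥ r≮q) r∈x

  _+_ : ℝ → ℝ → ℝ
  x + y = record
    { cut       = λ q → ∃₂ λ a b → a ∈ cut x × b ∈ cut y × q ≡ a ℚ.+ b
    ; inhabited = let a , a∈x = inhabited x ; b , b∈y = inhabited y in
                  a ℚ.+ b , a , b , a∈x , b∈y , refl
    ; bounded   = let p , p∉x = bounded x ; q , q∉y = bounded y in
                  p ℚ.+ q , λ (a , b , a∈x , b∈y , eq) →
                    ℚ.<-irrefl (sym eq) (ℚ.+-mono-< (cut-< x a∈x p∉x) (cut-< y b∈y q∉y))
    ; downward  = λ {p} {q} p<q (a , b , a∈x , b∈y , eq) →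
                  p ℚ.- b , b ,
                  downward x
                    (subst (p ℚ.- b ℚ.<_)
                      (trans (cong (ℚ._- b) eq) (a+b-b a b))
                      (ℚ.+-monoˡ-< (ℚ.- b) p<q))
                    a∈x ,
                  b∈y , sym (a-b+b p b)
    ; rounded   = λ (a , b , a∈x , b∈y , eq) →
                  let a′ , a<a′ , a′∈x = rounded x a∈x in
                  a′ ℚ.+ b ,
                  subst (ℚ._< a′ ℚ.+ b) (sym eq) (ℚ.+-monoˡ-< b a<a′) ,
                  a′ , b , a′∈x , b∈y , refl
    }
    where
    a+b-b : ∀ a b → a ℚ.+ b ℚ.- b ≡ a
    a+b-b = solve 2 (λ a b → a :+ b :- b := a) refl where open +-*-Solver

  halve : ℝ → ℝ
  halve x = record
    { cut       = λ q → q ℚ.+ q ∈ cut x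
    ; inhabited = let q , q∈x = inhabited x in
                  q ℚ.* ½ , subst (_∈ cut x) (sym (double-½ q)) q∈x
    ; bounded   = let q , q∉x = bounded x in
                  q ℚ.* ½ , λ h → q∉x (subst (_∈ cut x) (double-½ q) h)
    ; downward  = λ p<q → downward x (ℚ.+-mono-< p<q p<q)
    ; rounded   = λ q+q∈x → let r , q+q<r , r∈x = rounded x q+q∈x in
                  r ℚ.* ½ , half-< q+q<r , subst (_∈ cut x) (sym (double-½ r)) r∈x
    }

  _∧_ : ℝ → ℝ → ℝ
  x ∧ y = record
    { cut       = cut x ∩ cut y
    ; inhabited = inh
    ; bounded   = let q , q∉x = bounded x in q , λ (q∈x , _) → q∉x q∈x
    ; downward  = λ p<q (q∈x , q∈y) → downward x p<q q∈x , downward y p<q q∈y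
    ; rounded   = rnd
    }
    where
    inh : ∃ (cut x ∩ cut y)
    inh with inhabited x | inhabited y
    ... | a , a∈x | b , b∈y with ℚ.≤-total a b
    ...   | inj₁ a≤b = a , a∈x , downward-≤ y a≤b b∈y
    ...   | inj₂ b≤a = b , downward-≤ x b≤a a∈x , b∈y
    rnd : ∀ {q} → q ∈ cut x ∩ cut y → ∃ λ r → q ℚ.< r × r ∈ cut x ∩ cut y
    rnd (q∈x , q∈y) with rounded x q∈x | rounded y q∈y
    ... | a , q<a , a∈x | b , q<b , b∈y with ℚ.≤-total a b
    ...   | inj₁ a≤b = a , q<a , a∈x , downward-≤ y a≤b b∈y
    ...   | inj₂ b≤a = b , q<b , downward-≤ x b≤a a∈x , b∈y

  _∨_ : ℝ → ℝ → ℝ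
  x ∨ y = record
    { cut       = cut x ∪ cut y
    ; inhabited = let q , q∈x = inhabited x in q , inj₁ q∈x
    ; bounded   = bdd
    ; downward  = λ p<q → [ inj₁ ∘ downward x p<q , inj₂ ∘ downward y p<q ]′
    ; rounded   = [ (λ q∈x → let r , q<r , r∈x = rounded x q∈x in r , q<r , inj₁ r∈x)
                  , (λ q∈y → let r , q<r , r∈y = rounded y q∈y in r , q<r , inj₂ r∈y)
                  ]′
    }
    where
    bdd : ∃ λ q → q ∉ cut x ∪ cut y
    bdd with bounded x | bounded y
    ... | a , a∉x | b , b∉y with ℚ.≤-total a b
    ...   | inj₁ a≤b = b , [ (λ b∈x → a∉x (downward-≤ x a≤b b∈x)) , b∉y ]′
    ...   | inj₂ b≤a = a , [ a∉x , (λ a∈y → b∉y (downward-≤ y b≤a a∈y)) ]′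

  +-mono-≤ : ∀ {x y z w} → x ≤ y → z ≤ w → x + z ≤ y + w
  +-mono-≤ x≤y z≤w (a , b , a∈x , b∈z , eq) = a , b , x≤y a∈x , z≤w b∈z , eq

record 𝕀 : Set₁ where
  constructor mk𝕀
  field
    val    : ℝ
    nonNeg : Real._≤_ Real.0ℝ val
    ≤1     : Real._≤_ val Real.1ℝ

open 𝕀 public

module Interval where
  open Real using (0ℝ; 1ℝ; -1ℝ)

  infix  4 _≤_ _<_ _≈_
  infixr 6 _∨_ _∔_
  infixr 7 _∧_ _⊙_

  _≤_ _<_ _≈_ : Rel 𝕀 0ℓ
  p ≤ q = val p Real.≤ val q
  p < q = val p Real.< val q
  p ≈ q = p ≤ q × q ≤ p

  setoid : Setoid 1ℓ 0ℓ
  setoid = record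
    { Carrier       = 𝕀
    ; _≈_           = _≈_
    ; isEquivalence = record
      { refl  = (λ h → h) , (λ h → h)
      ; sym   = λ (h , k) → k , h
      ; trans = λ (h , k) (h′ , k′) → (λ z → h′ (h z)) , (λ z → k (k′ z))
      }
    }

  0𝕀 ½𝕀 1𝕀 : 𝕀
  0𝕀 = mk𝕀 0ℝ (λ h → h) (λ h → ℚ.<-trans h (ℚ.positive⁻¹ 1ℚ))
  1𝕀 = mk𝕀 1ℝ (λ h → ℚ.<-trans h (ℚ.positive⁻¹ 1ℚ)) (λ h → h)
  ½𝕀 = mk𝕀 (Real.fromℚ ½) (λ h → ℚ.<-trans h (ℚ.positive⁻¹ ½))
           (λ h → ℚ.<-trans h (ℚ.*<* (ℤ.+<+ (ℕ.s≤s (ℕ.s≤s ℕ.z≤n)))))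

  _∧_ _∨_ : 𝕀 → 𝕀 → 𝕀
  p ∧ q = mk𝕀 (val p Real.∧ val q) (λ h → nonNeg p h , nonNeg q h) (λ (h , _) → ≤1 p h)
  p ∨ q = mk𝕀 (val p Real.∨ val q) (λ h → inj₁ (nonNeg p h)) [ ≤1 p , ≤1 q ]′

  0≤+ : ∀ p q → 0ℝ Real.≤ val p Real.+ val q
  0≤+ p q {t} t<0 = t ℚ.* ½ , t ℚ.* ½ , nonNeg p t/2<0 , nonNeg q t/2<0 , sym (double-½ t)
    where
    t/2<0 : t ℚ.* ½ ℚ.< 0ℚ
    t/2<0 = subst (t ℚ.* ½ ℚ.<_) (ℚ.*-zeroˡ ½) (ℚ.*-monoˡ-<-pos ½ t<0)

  -- Truncated addition min(p + q, 1) and its dual max(p + q - 1, 0).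
  _∔_ _⊙_ : 𝕀 → 𝕀 → 𝕀
  p ∔ q = mk𝕀 ((val p Real.+ val q) Real.∧ 1ℝ) (λ h → 0≤+ p q h , nonNeg 1𝕀 h) proj₂
  p ⊙ q = mk𝕀 ((val p Real.+ val q Real.+ -1ℝ) Real.∨ 0ℝ) inj₂ [ +-1≤1 , ≤1 0𝕀 ]′
    where
    +-1≤1 : val p Real.+ val q Real.+ -1ℝ Real.≤ 1ℝ
    +-1≤1 (a , b , (c , d , c∈p , d∈q , refl) , b<-1 , refl) =
      ℚ.+-mono-< (ℚ.+-mono-< (≤1 p c∈p) (≤1 q d∈q)) b<-1

  double : ∀ q → q ≤ ½𝕀 → 𝕀
  double q q≤½ = mk𝕀 (val q Real.+ val q) (0≤+ q q)
    (λ { (a , b , a∈q , b∈q , refl) → ℚ.+-mono-< (q≤½ a∈q) (q≤½ b∈q) })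

  -- q ↦ (1 + q) / 2
  1+_/2 : 𝕀 → 𝕀
  1+ q /2 = mk𝕀 (Real.halve (1ℝ Real.+ val q)) (λ t<0 → 0≤+ 1𝕀 q (ℚ.+-mono-< t<0 t<0)) le
    where
    le : Real.halve (1ℝ Real.+ val q) Real.≤ 1ℝ
    le {t} (a , b , a<1 , b∈q , eq) with t ℚ.<? 1ℚ
    ... | yes t<1 = t<1
    ... | no  t≮1 = ⊥-elim (ℚ.<-irrefl refl (ℚ.≤-<-trans
            (ℚ.+-mono-≤ (ℚ.≮⇒≥ t≮1) (ℚ.≮⇒≥ t≮1))
            (subst (ℚ._< 1ℚ ℚ.+ 1ℚ) (sym eq) (ℚ.+-mono-< a<1 (≤1 q b∈q)))))

-- Subsets are predicates, so openness is required to be extensional, and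
-- open subsets to respect the equality of the underlying setoid.
record Topology (S : Setoid a e) (o t : Level) : Set (a ⊔ e ⊔ lsuc o ⊔ lsuc t) where
  open Setoid S using (Carrier; _≈_)
  field
    IsOpen     : Pred Carrier o → Set t
    IsOpen-≐   : ∀ {V W} → V ≐ W → IsOpen V → IsOpen W
    respects-≈ : ∀ {V} → IsOpen V → V Respects _≈_
    U-open     : IsOpen U
    ∩-open     : ∀ {V W} → IsOpen V → IsOpen W → IsOpen (V ∩ W)
    ⋃-open     : {I : Set o} (V : I → Pred Carrier o) → (∀ i → IsOpen (V i)) → IsOpen (⋃ I V)

  IsClosed : Pred Carrier o → Set t
  IsClosed C = IsOpen (∁ C)

  IsCompact : Set (a ⊔ lsuc o ⊔ t)
  IsCompact = {I : Set o} (V : I → Pred Carrier o) → (∀ i → IsOpen (V i)) →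
              (∀ x → x ∈ ⋃ I V) → ∃ λ (is : List I) → ∀ x → Any (λ i → x ∈ V i) is

module _ {a₁ e₁ a₂ e₂ o t₁ t₂ : Level} {S₁ : Setoid a₁ e₁} {S₂ : Setoid a₂ e₂} where

  Continuous : Topology S₁ o t₁ → Topology S₂ o t₂ →
               (Setoid.Carrier S₁ → Setoid.Carrier S₂) → Set _
  Continuous T₁ T₂ f = ∀ V → Topology.IsOpen T₂ V → Topology.IsOpen T₁ (f ⊢ V)

  product : Topology S₁ o t₁ → Topology S₂ o t₂ →
            Topology (×-setoid S₁ S₂) o (a₁ ⊔ a₂ ⊔ lsuc o ⊔ t₁ ⊔ t₂)
  product T₁ T₂ = record
    { IsOpen     = λ W → ∀ x y → (x , y) ∈ W → ∃₂ λ V₁ V₂ →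
                     T₁.IsOpen V₁ × T₂.IsOpen V₂ × x ∈ V₁ × y ∈ V₂ × (V₁ ⟨×⟩ V₂) ⊆ W
    ; IsOpen-≐   = λ (V⊆W , W⊆V) open-V x y xy∈W →
                     let V₁ , V₂ , o₁ , o₂ , x∈ , y∈ , sub = open-V x y (W⊆V xy∈W) in
                     V₁ , V₂ , o₁ , o₂ , x∈ , y∈ , (λ h → V⊆W (sub h))
    ; respects-≈ = λ open-V {xy} (x≈ , y≈) xy∈V →
                     let V₁ , V₂ , o₁ , o₂ , x∈ , y∈ , sub = open-V (proj₁ xy) (proj₂ xy) xy∈V in
                     sub (T₁.respects-≈ o₁ x≈ x∈ , T₂.respects-≈ o₂ y≈ y∈)
    ; U-open     = λ _ _ _ → U , U , T₁.U-open , T₂.U-open , tt , tt , _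
    ; ∩-open     = λ open-V open-W x y (xy∈V , xy∈W) →
                     let V₁ , V₂ , o₁ , o₂ , x∈V , y∈V , subV = open-V x y xy∈V
                         W₁ , W₂ , p₁ , p₂ , x∈W , y∈W , subW = open-W x y xy∈W
                     in V₁ ∩ W₁ , V₂ ∩ W₂ , T₁.∩-open o₁ p₁ , T₂.∩-open o₂ p₂ ,
                        (x∈V , x∈W) , (y∈V , y∈W) ,
                        λ ((h , h′) , (k , k′)) → subV (h , k) , subW (h′ , k′)
    ; ⋃-open     = λ V open-V x y (i , xy∈V) →
                     let V₁ , V₂ , o₁ , o₂ , x∈ , y∈ , sub = open-V i x y xy∈V in
                     V₁ , V₂ , o₁ , o₂ , x∈ , y∈ , λ h → i , sub h
    }
    where
    module T₁ = Topology T₁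
    module T₂ = Topology T₂

record CompactOrderedSpace (ℓ : Level) : Set (lsuc (lsuc ℓ)) where
  field
    poset : Poset ℓ ℓ ℓ

  open Poset poset public

  field
    topology  : Topology Eq.setoid ℓ (lsuc ℓ)
    compact   : Topology.IsCompact topology
    hausdorff : Topology.IsClosed (product topology topology) λ (x , y) → x ≤ y

  open Topology topology public

-- The Euclidean topology on [0,1]: intervals with rational endpoints form a base.
𝕀-topology : ∀ o → Topology Interval.setoid o (1ℓ ⊔ o)
𝕀-topology o = record
  { IsOpen     = λ V → ∀ x → x ∈ V → ∃₂ λ p q → x ∈[ p , q ] × (∀ y → y ∈[ p , q ] → y ∈ V)
  ; IsOpen-≐   = λ (V⊆W , W⊆V) open-V x x∈W →
                   let p , q , x∈pq , sub = open-V x (W⊆V x∈W) in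
                   p , q , x∈pq , λ y h → V⊆W (sub y h)
  ; respects-≈ = λ {V} open-V {x} {y} (x≤y , y≤x) x∈V →
                   let p , q , (p<x , x<q) , sub = open-V x x∈V in
                   sub y ( Real.<-≤-trans {Real.fromℚ p} {val x} {val y} p<x x≤y
                       , Real.≤-<-trans {val y} {val x} {Real.fromℚ q} y≤x x<q )
  ; U-open     = λ x _ →
                   let p , p∈x = inhabited (val x)
                       q , q∉x = bounded (val x)
                   in p , q ℚ.+ 1ℚ ,
                      (Real.∈⇒fromℚ< (val x) p∈x , q , q∉x , p<p+1 q) , λ _ _ → tt
  ; ∩-open     = λ open-V open-W x (x∈V , x∈W) →
                   let p , q , (p<x , x<q) , subV = open-V x x∈V
                       r , s , (r<x , x<s) , subW = open-W x x∈W
                   in p ℚ.⊔ r , q ℚ.⊓ s ,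
                      (max-< p r (val x) p<x r<x , min-> q s (val x) x<q x<s) ,
                      λ y (l , u) →
                        subV y ( Real.≤-<-trans {Real.fromℚ p} {Real.fromℚ (p ℚ.⊔ r)} {val y}
                                 (λ h → ℚ.<-≤-trans h (ℚ.p≤p⊔q p r)) l
                             , Real.<-≤-trans {val y} {Real.fromℚ (q ℚ.⊓ s)} {Real.fromℚ q}
                                 u (λ h → ℚ.<-≤-trans h (ℚ.p⊓q≤p q s)) ) ,
                        subW y ( Real.≤-<-trans {Real.fromℚ r} {Real.fromℚ (p ℚ.⊔ r)} {val y}
                                 (λ h → ℚ.<-≤-trans h (ℚ.p≤q⊔p p r)) l
                             , Real.<-≤-trans {val y} {Real.fromℚ (q ℚ.⊓ s)} {Real.fromℚ s}
                                 u (λ h → ℚ.<-≤-trans h (ℚ.p⊓q≤q q s)) )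
  ; ⋃-open     = λ V open-V x (i , x∈V) →
                   let p , q , x∈pq , sub = open-V i x x∈V in
                   p , q , x∈pq , λ y h → i , sub y h
  }
  where
  infix 4 _∈[_,_]
  _∈[_,_] : 𝕀 → ℚ → ℚ → Set
  x ∈[ p , q ] = Real.fromℚ p Real.< val x × val x Real.< Real.fromℚ q

  max-< : ∀ p r x → Real.fromℚ p Real.< x → Real.fromℚ r Real.< x → Real.fromℚ (p ℚ.⊔ r) Real.< x
  max-< p r x p<x r<x with ℚ.≤-total p r
  ... | inj₁ p≤r = subst (λ z → Real.fromℚ z Real.< x) (sym (ℚ.p≤q⇒p⊔q≡q p≤r)) r<x
  ... | inj₂ r≤p = subst (λ z → Real.fromℚ z Real.< x) (sym (ℚ.p≥q⇒p⊔q≡p r≤p)) p<x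

  min-> : ∀ q s x → x Real.< Real.fromℚ q → x Real.< Real.fromℚ s → x Real.< Real.fromℚ (q ℚ.⊓ s)
  min-> q s x x<q x<s with ℚ.≤-total q s
  ... | inj₁ q≤s = subst (λ z → x Real.< Real.fromℚ z) (sym (ℚ.p≤q⇒p⊓q≡p q≤s)) x<q
  ... | inj₂ s≤q = subst (λ z → x Real.< Real.fromℚ z) (sym (ℚ.p≥q⇒p⊓q≡q s≤q)) x<s

record RawMCAlgebra (a e : Level) : Set (1ℓ ⊔ lsuc (a ⊔ e)) where
  infixr 6 _∨_ _∔_
  infixr 7 _∧_ _⊙_
  field
    setoid : Setoid a e
  open Setoid setoid public using (Carrier; _≈_)
  field
    _∨_ _∧_ _∔_ _⊙_ : Op₂ Carrier
    const           : 𝕀 → Carrier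

infix 4 _≅_

record _≅_ {a₁ e₁ a₂ e₂ : Level} (A : RawMCAlgebra a₁ e₁) (B : RawMCAlgebra a₂ e₂) :
           Set (1ℓ ⊔ a₁ ⊔ e₁ ⊔ a₂ ⊔ e₂) where
  private
    module A = RawMCAlgebra A
    module B = RawMCAlgebra B
  field
    bijection : Bijection A.setoid B.setoid
  open Bijection bijection public using (to)
  open Morphism A.Carrier B.Carrier B._≈_ using (Homomorphic₀; Homomorphic₂)
  field
    ∨-homo     : Homomorphic₂ to A._∨_ B._∨_
    ∧-homo     : Homomorphic₂ to A._∧_ B._∧_
    ∔-homo     : Homomorphic₂ to A._∔_ B._∔_
    ⊙-homo     : Homomorphic₂ to A._⊙_ B._⊙_
    const-homo : ∀ c → Homomorphic₀ to (A.const c) (B.const c)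

IsLub : {A : Set a} → Rel A ℓ → Pred A o → A → Set _
IsLub _≤_ S s = (∀ {x} → x ∈ S → x ≤ s) × (∀ u → (∀ {x} → x ∈ S → x ≤ u) → s ≤ u)

image : {A : Set a} {B : Set b} → (A → B) → Pred A o → Pred B _
image f S y = ∃ λ x → x ∈ S × f x ≡ y

-- The level of the subsets is large enough for images of subsets of [0,1];
-- under excluded middle it is immaterial.
record CompleteBooleanAlgebra (c ℓ₁ ℓ₂ : Level) : Set (lsuc (1ℓ ⊔ c ⊔ ℓ₁ ⊔ ℓ₂)) where
  field
    booleanAlgebra : BooleanAlgebra c ℓ₁ ℓ₂

  open BooleanAlgebra booleanAlgebra public

  field
    ⋁     : Pred Carrier (1ℓ ⊔ c) → Carrier
    ⋁-lub : ∀ S → IsLub _≤_ S (⋁ S)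

-- The algebras USC(B) and C↗(X).  Excluded middle for arbitrary types, which
-- also yields choice, stands for the classical metatheory; it decides the case
-- distinctions on reals in the operations of USC(B).

module Classical (em : ∀ {ℓ} → ExcludedMiddle ℓ) where

  private
    open Interval using (_≤_; _<_; 0𝕀; ½𝕀; 1𝕀; double; 1+_/2)

  ≰⇒> : ∀ {x y} → ¬ x Real.≤ y → y Real.< x
  ≰⇒> {x} {y} x≰y with em {P = y Real.< x}
  ... | yes y<x = y<x
  ... | no  y≮x = ⊥-elim (x≰y λ {q} q∈x → in-y q q∈x)
    where
    in-y : ∀ q → q ∈ cut x → q ∈ cut y
    in-y q q∈x with em {P = q ∈ cut y}
    ... | yes q∈y = q∈y
    ... | no  q∉y = ⊥-elim (y≮x (q , q∉y , q∈x))

  ≤-total : ∀ p q → p ≤ q ⊎ q ≤ p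
  ≤-total p q with em {P = p ≤ q}
  ... | yes p≤q = inj₁ p≤q
  ... | no  p≰q = inj₂ (Real.<⇒≤ {val q} {val p} (≰⇒> {val p} {val q} p≰q))

  lub-∈ : ∀ {S : Pred 𝕀 1ℓ} {s t} → IsLub _≤_ S s → 0ℚ ℚ.≤ t → t ∈ cut (val s) →
          ∃ λ q → q ∈ S × t ∈ cut (val q)
  lub-∈ {S} {s} {t} (_ , least) 0≤t t∈s with em {P = ∃ λ q → q ∈ S × t ∈ cut (val q)}
  ... | yes ∃q = ∃q
  ... | no ∄q = ⊥-elim (ℚ.<-irrefl refl (least t𝕀 S≤t t∈s))
    where
    t𝕀 : 𝕀
    t𝕀 = mk𝕀 (Real.fromℚ t) (λ h → ℚ.<-≤-trans h 0≤t) (λ h → ℚ.<-trans h (≤1 s t∈s))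
    S≤t : ∀ {q} → q ∈ S → q ≤ t𝕀
    S≤t {q} q∈S h = Real.cut-< (val q) h λ t∈q → ∄q (q , q∈S , t∈q)

  lub-< : ∀ {S : Pred 𝕀 1ℓ} {s} x → Real.0ℝ Real.≤ x → IsLub _≤_ S s → x Real.< val s →
          ∃ λ q → q ∈ S × x Real.< val q
  lub-< {S} {s} x 0≤x lub (t , t∉x , t∈s) =
    let q , q∈S , t∈q = lub-∈ {S} {s} lub (ℚ.≮⇒≥ (λ t<0 → t∉x (0≤x t<0))) t∈s in
    q , q∈S , t , t∉x , t∈q

  double-mono : ∀ {p q} (h : p ≤ ½𝕀) (k : q ≤ ½𝕀) → p ≤ q → double p h ≤ double q k
  double-mono {p} {q} _ _ p≤q =
    Real.+-mono-≤ {val p} {val q} {val p} {val q} p≤q p≤q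

  1+/2-mono : ∀ {p q} → p ≤ q → (1+ p /2) ≤ (1+ q /2)
  1+/2-mono {p} {q} p≤q =
    Real.+-mono-≤ {Real.1ℝ} {Real.1ℝ} {val p} {val q} (λ h → h) p≤q

  Doubles : Pred 𝕀 1ℓ → Pred 𝕀 1ℓ
  Doubles S x = ∃ λ q → q ∈ S × Σ (q ≤ ½𝕀) λ q≤½ → double q q≤½ ≡ x

  double-lub : ∀ {S s} (s≤½ : s ≤ ½𝕀) → IsLub _≤_ S s → IsLub _≤_ (Doubles S) (double s s≤½)
  double-lub {S} {s} s≤½ lub =
    (λ { (q , q∈S , q≤½ , refl) → double-mono {q} {s} q≤½ s≤½ (proj₁ lub q∈S) }) , least
    where
    cover : ∀ u → (∀ {x} → x ∈ Doubles S → x ≤ u) → ∀ {a b c} →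
            c ∈ cut (val s) → a ℚ.≤ c → b ℚ.≤ c → a ℚ.+ b ∈ cut (val u)
    cover u ub {a} {b} {c} c∈s a≤c b≤c with c ℚ.<? 0ℚ
    ... | yes c<0 = nonNeg u (ℚ.+-mono-< (ℚ.≤-<-trans a≤c c<0) (ℚ.≤-<-trans b≤c c<0))
    ... | no  c≮0 =
      let c′ , c<c′ , c′∈s = rounded (val s) c∈s
          q , q∈S , c′∈q = lub-∈ {S} {s} lub (ℚ.≤-trans (ℚ.≮⇒≥ c≮0) (ℚ.<⇒≤ c<c′)) c′∈s
          q≤½ : q ≤ ½𝕀
          q≤½ = λ h → s≤½ (proj₁ lub q∈S h)
      in ub (q , q∈S , q≤½ , refl)
            ( a , b
            , downward (val q) (ℚ.≤-<-trans a≤c c<c′) c′∈q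
            , downward (val q) (ℚ.≤-<-trans b≤c c<c′) c′∈q , refl )
    least : ∀ u → (∀ {x} → x ∈ Doubles S → x ≤ u) → double s s≤½ ≤ u
    least u ub (a , b , a∈s , b∈s , refl) with ℚ.≤-total a b
    ... | inj₁ a≤b = cover u ub b∈s a≤b ℚ.≤-refl
    ... | inj₂ b≤a = cover u ub a∈s ℚ.≤-refl b≤a

  Averages : Pred 𝕀 1ℓ → Pred 𝕀 1ℓ
  Averages S x = ∃ λ q → q ∈ S × 0𝕀 < q × (1+ q /2) ≡ x

  1+/2-lub : ∀ {S s} → 0𝕀 < s → IsLub _≤_ S s → IsLub _≤_ (Averages S) (1+ s /2)
  1+/2-lub {S} {s} 0<s lub =
    (λ { (q , q∈S , _ , refl) {t} → 1+/2-mono {q} {s} (proj₁ lub q∈S) {t} }) , least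
    where
    least : ∀ u → (∀ {x} → x ∈ Averages S → x ≤ u) → (1+ s /2) ≤ u
    least u ub {t} (a , b , a<1 , b∈s , eq) with b ℚ.<? 0ℚ
    ... | no b≮0 =
      let b′ , b<b′ , b′∈s = rounded (val s) b∈s
          q , q∈S , b′∈q = lub-∈ {S} {s} lub (ℚ.≤-trans (ℚ.≮⇒≥ b≮0) (ℚ.<⇒≤ b<b′)) b′∈s
      in ub (q , q∈S , (b , b≮0 , downward (val q) b<b′ b′∈q) , refl)
            (a , b , a<1 , downward (val q) b<b′ b′∈q , eq)
    ... | yes b<0 =
      let q , q∈S , 0<q = lub-< {S} {s} Real.0ℝ (λ h → h) lub 0<s in
      ub (q , q∈S , 0<q , refl) (a , b , a<1 , nonNeg q b<0 , eq)

  module _ {c ℓ₁ ℓ₂ : Level} (B : CompleteBooleanAlgebra c ℓ₁ ℓ₂) where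

    private
      module B = CompleteBooleanAlgebra B
      open B using (⊤; ⊥; _∧_; _∨_; ⋁) renaming (Carrier to |B|)
      open HeytingAlgebraProperties B.heytingAlgebra using (swap-transpose-⇨; ⇨-eval)
      open MeetSemilatticeProperties B.meetSemilattice using (∧-monotonic; ∧-comm)

    PreservesSups : (𝕀 → |B|) → Set (lsuc 1ℓ ⊔ c ⊔ ℓ₂)
    PreservesSups f = ∀ (S : Pred 𝕀 1ℓ) s → IsLub _≤_ S s → IsLub B._≤_ (image f S) (f s)

    record USCMap : Set (lsuc 1ℓ ⊔ c ⊔ ℓ₂) where
      constructor _,ₛ_
      field
        app      : 𝕀 → |B|
        sup-pres : PreservesSups app

    open USCMap public

    app-mono : ∀ (f : USCMap) {p q} → p ≤ q → app f p B.≤ app f q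
    app-mono f {p} {q} p≤q =
      proj₁ (sup-pres f (λ x → x ≡ p ⊎ x ≡ q) q
        ((λ { (inj₁ refl) → p≤q ; (inj₂ refl) h → h }) , λ u ub → ub (inj₂ refl)))
        (p , inj₁ refl , refl)

    app-least : ∀ (f : USCMap) S s {u} → IsLub _≤_ S s →
                (∀ q → q ∈ S → app f q B.≤ u) → app f s B.≤ u
    app-least f S s lub ub =
      proj₂ (sup-pres f S s lub) _ λ { (q , q∈S , refl) → ub q q∈S }

    mk-sup-pres : ∀ (f : 𝕀 → |B|) → (∀ p q → p ≤ q → f p B.≤ f q) →
                  (∀ S s u → IsLub _≤_ S s → (∀ q → q ∈ S → f q B.≤ u) → f s B.≤ u) →
                  PreservesSups f
    mk-sup-pres f mono least S s lub =
      (λ { (q , q∈S , refl) → mono q s (proj₁ lub q∈S) }) ,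
      λ u ub → least S s u lub λ q q∈S → ub (q , q∈S , refl)

    infix  4 _≤ᵤ_ _≈ᵤ_
    infixr 6 _∨ᵤ_ _∔ᵤ_
    infixr 7 _∧ᵤ_ _⊙ᵤ_

    _≈ᵤ_ : Rel USCMap (1ℓ ⊔ ℓ₁)
    f ≈ᵤ g = ∀ q → app f q B.≈ app g q

    _≤ᵤ_ : Rel USCMap (1ℓ ⊔ ℓ₂)
    f ≤ᵤ g = ∀ q → app g q B.≤ app f q

    USC-setoid : Setoid (lsuc 1ℓ ⊔ c ⊔ ℓ₂) (1ℓ ⊔ ℓ₁)
    USC-setoid = record
      { Carrier       = USCMap
      ; _≈_           = _≈ᵤ_
      ; isEquivalence = record
        { refl  = λ _ → B.Eq.refl
        ; sym   = λ h q → B.Eq.sym (h q)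
        ; trans = λ h k q → B.Eq.trans (h q) (k q)
        }
      }

    -- The order being reversed, joins in USC(B) are meets in B and vice versa.

    _∨ᵤ_ : USCMap → USCMap → USCMap
    f ∨ᵤ g = (λ q → app f q ∧ app g q) ,ₛ mk-sup-pres _
      (λ p q p≤q → ∧-monotonic (app-mono f p≤q) (app-mono g p≤q))
      (λ S s u lub ub → B.transpose-∧ (app-least f S s lub λ p p∈S →
        B.transpose-⇨ (B.trans (B.reflexive (∧-comm _ _))
          (B.transpose-∧ (app-least g S s lub λ q q∈S →
            B.transpose-⇨ (below S u ub p q p∈S q∈S))))))
      where
      below : ∀ S u → (∀ q → q ∈ S → app f q ∧ app g q B.≤ u) →
              ∀ p q → p ∈ S → q ∈ S → app g q ∧ app f p B.≤ u
      below S u ub p q p∈S q∈S with ≤-total p q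
      ... | inj₁ p≤q = B.trans (B.reflexive (∧-comm _ _))
              (B.trans (∧-monotonic (app-mono f p≤q) B.refl) (ub q q∈S))
      ... | inj₂ q≤p = B.trans (B.reflexive (∧-comm _ _))
              (B.trans (∧-monotonic B.refl (app-mono g q≤p)) (ub p p∈S))

    ∨ᵤ-supremum : Supremum _≤ᵤ_ _∨ᵤ_
    ∨ᵤ-supremum f g =
      (λ q → B.x∧y≤x _ _) , (λ q → B.x∧y≤y _ _) , λ h f≤h g≤h q → B.∧-greatest (f≤h q) (g≤h q)

    _∧ᵤ_ : USCMap → USCMap → USCMap
    f ∧ᵤ g = (λ q → app f q ∨ app g q) ,ₛ mk-sup-pres _
      (λ p q p≤q → B.∨-least (B.trans (app-mono f p≤q) (B.x≤x∨y _ _))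
                             (B.trans (app-mono g p≤q) (B.y≤x∨y _ _)))
      (λ S s u lub ub → B.∨-least
        (app-least f S s lub λ q q∈S → B.trans (B.x≤x∨y _ _) (ub q q∈S))
        (app-least g S s lub λ q q∈S → B.trans (B.y≤x∨y _ _) (ub q q∈S)))

    ∧ᵤ-infimum : Infimum _≤ᵤ_ _∧ᵤ_
    ∧ᵤ-infimum f g =
      (λ q → B.x≤x∨y _ _) , (λ q → B.y≤x∨y _ _) , λ h h≤f h≤g q → B.∨-least (h≤f q) (h≤g q)

    constᵤ : 𝕀 → USCMap
    constᵤ k = value ,ₛ mk-sup-pres value mono least
      where
      value : 𝕀 → |B|
      value q with em {P = k < q}
      ... | yes _ = ⊤
      ... | no  _ = ⊥
      mono : ∀ p q → p ≤ q → value p B.≤ value q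
      mono p q p≤q with em {P = k < p} | em {P = k < q}
      ... | _       | yes _   = B.maximum _
      ... | no _    | no _    = B.minimum _
      ... | yes k<p | no k≮q  = ⊥-elim (k≮q (Real.<-≤-trans {val k} {val p} {val q} k<p p≤q))
      least : ∀ S s u → IsLub _≤_ S s → (∀ q → q ∈ S → value q B.≤ u) → value s B.≤ u
      least S s u lub ub with em {P = k < s}
      ... | no _    = B.minimum _
      ... | yes k<s with lub-< {S} {s} (val k) (nonNeg k) lub k<s
      ...   | q , q∈S , k<q with em {P = k < q} | ub q q∈S
      ...     | yes _  | ⊤≤u = ⊤≤u
      ...     | no k≮q | _   = ⊥-elim (k≮q k<q)

    _∔ᵤ_ : USCMap → USCMap → USCMap
    f ∔ᵤ g = (λ q → ⋁ (below q)) ,ₛ mk-sup-pres _ mono least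
      where
      below : 𝕀 → Pred |B| (1ℓ ⊔ c)
      below q b = ∃₂ λ p r → val p Real.+ val r Real.< val q × b ≡ app f p ∧ app g r
      mono : ∀ p q → p ≤ q → ⋁ (below p) B.≤ ⋁ (below q)
      mono p q p≤q = proj₂ (B.⋁-lub (below p)) _ λ (x , y , x+y<p , eq) →
        proj₁ (B.⋁-lub (below q))
          (x , y , Real.<-≤-trans {val x Real.+ val y} {val p} {val q} x+y<p p≤q , eq)
      least : ∀ S s u → IsLub _≤_ S s → (∀ q → q ∈ S → ⋁ (below q) B.≤ u) → ⋁ (below s) B.≤ u
      least S s u lub ub = proj₂ (B.⋁-lub (below s)) u λ (x , y , x+y<s , eq) →
        let q , q∈S , x+y<q =
              lub-< {S} {s} (val x Real.+ val y) (Interval.0≤+ x y) lub x+y<s in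
        B.trans (proj₁ (B.⋁-lub (below q)) (x , y , x+y<q , eq)) (ub q q∈S)

    halfᵤ : USCMap → USCMap
    halfᵤ f = value ,ₛ mk-sup-pres value mono least
      where
      value : 𝕀 → |B|
      value q with em {P = q ≤ ½𝕀}
      ... | yes q≤½ = app f (double q q≤½)
      ... | no  _   = ⊤
      mono : ∀ p q → p ≤ q → value p B.≤ value q
      mono p q p≤q with em {P = p ≤ ½𝕀} | em {P = q ≤ ½𝕀}
      ... | _       | no _    = B.maximum _
      ... | yes p≤½ | yes q≤½ = app-mono f (double-mono {p} {q} p≤½ q≤½ p≤q)
      ... | no p≰½  | yes q≤½ = ⊥-elim (p≰½ λ h → q≤½ (p≤q h))
      least : ∀ S s u → IsLub _≤_ S s → (∀ q → q ∈ S → value q B.≤ u) → value s B.≤ u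
      least S s u lub ub with em {P = s ≤ ½𝕀}
      ... | yes s≤½ = app-least f (Doubles S) (double s s≤½) (double-lub {S} {s} s≤½ lub)
                        λ { _ (q , q∈S , q≤½ , refl) → bound q q∈S q≤½ }
        where
        bound : ∀ q → q ∈ S → (q≤½ : q ≤ ½𝕀) → app f (double q q≤½) B.≤ u
        bound q q∈S q≤½ with em {P = q ≤ ½𝕀} | ub q q∈S
        ... | yes q≤½′ | h = B.trans (app-mono f (double-mono {q} {q} q≤½ q≤½′ λ t → t)) h
        ... | no q≰½   | _ = ⊥-elim (q≰½ q≤½)
      ... | no s≰½ with lub-< {S} {s} (val ½𝕀) (nonNeg ½𝕀) lub (≰⇒> {val s} {val ½𝕀} s≰½)
      ...   | q , q∈S , ½<q with em {P = q ≤ ½𝕀} | ub q q∈S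
      ...     | no _    | ⊤≤u = ⊤≤u
      ...     | yes q≤½ | _   = ⊥-elim (Real.<⇒≱ {val ½𝕀} {val q} ½<q q≤½)

    jᵤ : USCMap → USCMap
    jᵤ f = value ,ₛ mk-sup-pres value mono least
      where
      value : 𝕀 → |B|
      value q with em {P = 0𝕀 < q}
      ... | yes _ = app f (1+ q /2)
      ... | no  _ = ⊥
      mono : ∀ p q → p ≤ q → value p B.≤ value q
      mono p q p≤q with em {P = 0𝕀 < p} | em {P = 0𝕀 < q}
      ... | no _    | _       = B.minimum _
      ... | yes _   | yes _   = app-mono f λ {t} → 1+/2-mono {p} {q} p≤q {t}
      ... | yes 0<p | no 0≮q  =
        ⊥-elim (0≮q (Real.<-≤-trans {Real.0ℝ} {val p} {val q} 0<p p≤q))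
      least : ∀ S s u → IsLub _≤_ S s → (∀ q → q ∈ S → value q B.≤ u) → value s B.≤ u
      least S s u lub ub with em {P = 0𝕀 < s}
      ... | no _    = B.minimum _
      ... | yes 0<s = app-least f (Averages S) (1+ s /2) (1+/2-lub {S} {s} 0<s lub)
                        λ { _ (q , q∈S , 0<q , refl) → bound q q∈S 0<q }
        where
        bound : ∀ q → q ∈ S → 0𝕀 < q → app f (1+ q /2) B.≤ u
        bound q q∈S 0<q with em {P = 0𝕀 < q} | ub q q∈S
        ... | yes _  | h = h
        ... | no 0≮q | _ = ⊥-elim (0≮q 0<q)

    _⊙ᵤ_ : USCMap → USCMap → USCMap
    f ⊙ᵤ g = jᵤ (halfᵤ f ∔ᵤ halfᵤ g)

    USC : RawMCAlgebra (lsuc 1ℓ ⊔ c ⊔ ℓ₂) (1ℓ ⊔ ℓ₁)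
    USC = record
      { setoid = USC-setoid
      ; _∨_    = _∨ᵤ_
      ; _∧_    = _∧ᵤ_
      ; _∔_    = _∔ᵤ_
      ; _⊙_    = _⊙ᵤ_
      ; const  = constᵤ
      }

  private
    open Real using (fromℚ; ∈⇒fromℚ<; fromℚ<⇒∈)

  cut-gap : ∀ x {δ} → 0ℚ ℚ.< δ → ∃ λ p → p ∈ cut x × p ℚ.+ δ ∉ cut x
  cut-gap x {δ} 0<δ with em {P = ∃ λ p → p ∈ cut x × p ℚ.+ δ ∉ cut x}
  ... | yes gap = gap
  ... | no ¬gap = ⊥-elim (ℚ.<-irrefl refl (ℚ.<-≤-trans (Real.cut-< x (steps n) q∉x) q≤p+nδ))
    where
    p = proj₁ (inhabited x)
    q = proj₁ (bounded x)
    q∉x = proj₂ (bounded x)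
    step : ∀ {r} → r ∈ cut x → r ℚ.+ δ ∈ cut x
    step {r} r∈x with em {P = r ℚ.+ δ ∈ cut x}
    ... | yes r+δ∈x = r+δ∈x
    ... | no  r+δ∉x = ⊥-elim (¬gap (r , r∈x , r+δ∉x))
    steps : ∀ n → p ℚ.+ n · δ ∈ cut x
    steps zero    = subst (_∈ cut x) (sym (ℚ.+-identityʳ p)) (proj₂ (inhabited x))
    steps (suc n) = subst (_∈ cut x) (ℚ.+-assoc p (n · δ) δ) (step (steps n))
    n = proj₁ (archimedean (q ℚ.- p) 0<δ)
    q≤p+nδ : q ℚ.≤ p ℚ.+ n · δ
    q≤p+nδ = subst (ℚ._≤ p ℚ.+ n · δ) (p+[q-p] p q)
               (ℚ.+-monoʳ-≤ p (proj₂ (archimedean (q ℚ.- p) 0<δ)))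
      where
      p+[q-p] : ∀ p q → p ℚ.+ (q ℚ.- p) ≡ q
      p+[q-p] = solve 2 (λ p q → p :+ (q :- p) := q) refl where open +-*-Solver

  +-split : ∀ x y {t b} → t ∉ cut (x Real.+ y) → t ℚ.< b →
            ∃₂ λ c d → c ∉ cut x × d ∉ cut y × c ℚ.+ d ≡ b
  +-split x y {t} {b} t∉x+y t<b =
    let δ = b ℚ.- t
        p , p∈x , p+δ∉x = cut-gap x {δ} (<⇒0<- t<b)
    in p ℚ.+ δ , t ℚ.- p , p+δ∉x ,
       (λ t-p∈y → t∉x+y (p , t ℚ.- p , p∈x , t-p∈y , sym (p+[t-p] p t))) ,
       regroup p t b
    where
    open +-*-Solver
    p+[t-p] : ∀ p t → p ℚ.+ (t ℚ.- p) ≡ t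
    p+[t-p] = solve 2 (λ p t → p :+ (t :- p) := t) refl
    regroup : ∀ p t b → p ℚ.+ (b ℚ.- t) ℚ.+ (t ℚ.- p) ≡ b
    regroup = solve 3 (λ p t b → p :+ (b :- t) :+ (t :- p) := b) refl

  module _ {ℓ : Level} (X : CompactOrderedSpace ℓ) where

    private
      module X = CompactOrderedSpace X
      open X using () renaming (Carrier to |X|)

    record C↗Map : Set (1ℓ ⊔ lsuc ℓ) where
      field
        fun        : |X| → 𝕀
        continuous : Continuous X.topology (𝕀-topology ℓ) fun
        monotone   : ∀ {x y} → x X.≤ y → fun x ≤ fun y

    open C↗Map public

    Near : |X| → Pred |X| ℓ → Set (lsuc ℓ)
    Near x P = ∃ λ V → X.IsOpen V × x ∈ V × V ⊆ P

    Lsc Usc : (|X| → ℝ) → Set (lsuc ℓ)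
    Lsc h = ∀ x {a} → a ∈ cut (h x) → Near x λ y → Lift ℓ (a ∈ cut (h y))
    Usc h = ∀ x {b} → h x Real.< fromℚ b → Near x λ y → Lift ℓ (h y Real.< fromℚ b)

    record Cts (h : |X| → ℝ) : Set (lsuc ℓ) where
      constructor cts
      field
        lsc : Lsc h
        usc : Usc h

    open Cts public

    near-map : ∀ {x P Q} → P ⊆ Q → Near x P → Near x Q
    near-map P⊆Q (V , o , x∈V , V⊆P) = V , o , x∈V , λ h → P⊆Q (V⊆P h)

    near-∩ : ∀ {x P Q} → Near x P → Near x Q → Near x (P ∩ Q)
    near-∩ (V , o , x∈V , V⊆P) (W , o′ , x∈W , W⊆Q) =
      V ∩ W , X.∩-open o o′ , (x∈V , x∈W) , λ (h , k) → V⊆P h , W⊆Q k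

    near-U : ∀ {x P} → (∀ y → y ∈ P) → Near x P
    near-U all = U , X.U-open , tt , λ {y} _ → all y

    near-open : ∀ {W} → (∀ x → x ∈ W → Near x W) → X.IsOpen W
    near-open {W} near = X.IsOpen-≐
      ( (λ { ((x , x∈W) , h) → proj₂ (proj₂ (proj₂ (near x x∈W))) h })
      , (λ {x} x∈W → (x , x∈W) , proj₁ (proj₂ (proj₂ (near x x∈W)))) )
      (X.⋃-open {I = ∃ W} (λ (x , x∈W) → proj₁ (near x x∈W))
                          (λ (x , x∈W) → proj₁ (proj₂ (near x x∈W))))

    fun-lsc : ∀ f → Lsc (val ∘ fun f)
    fun-lsc f x {a} a∈fx = fun f ⊢ V , continuous f V V-open , lift a∈fx , λ h → h
      where
      V : Pred 𝕀 ℓ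
      V p = Lift ℓ (a ∈ cut (val p))
      V-open : Topology.IsOpen (𝕀-topology ℓ) V
      V-open p (lift a∈p) =
        let b , b∉p = bounded (val p) in
        a , b ℚ.+ 1ℚ , (∈⇒fromℚ< (val p) a∈p , b , b∉p , p<p+1 b) ,
        λ q (a<q , _) → lift (fromℚ<⇒∈ (val q) a<q)

    fun-usc : ∀ f → Usc (val ∘ fun f)
    fun-usc f x {b} fx<b = fun f ⊢ V , continuous f V V-open , lift fx<b , λ h → h
      where
      V : Pred 𝕀 ℓ
      V p = Lift ℓ (val p Real.< fromℚ b)
      V-open : Topology.IsOpen (𝕀-topology ℓ) V
      V-open p (lift p<b) =
        let a , a∈p = inhabited (val p) in
        a , b , (∈⇒fromℚ< (val p) a∈p , p<b) , λ _ (_ , q<b) → lift q<b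

    fun-cts : ∀ f → Cts (val ∘ fun f)
    fun-cts f = cts (fun-lsc f) (fun-usc f)

    cts⇒continuous : (f : |X| → 𝕀) → Cts (val ∘ f) →
                     Continuous X.topology (𝕀-topology ℓ) f
    cts⇒continuous f (cts l u) V V-open = near-open λ x fx∈V →
      let a , b , (a<fx , fx<b) , sub = V-open (f x) fx∈V in
      near-map
        (λ { {y} (lift a∈fy , lift fy<b) → sub (f y) (∈⇒fromℚ< (val (f y)) a∈fy , fy<b) })
        (near-∩ (l x (fromℚ<⇒∈ (val (f x)) a<fx)) (u x fx<b))

    const-cts : ∀ r → Cts (λ _ → r)
    const-cts r = cts (λ x a∈r → near-U λ _ → lift a∈r) (λ x r<b → near-U λ _ → lift r<b)

    module _ {h k : |X| → ℝ} (H : Cts h) (K : Cts k) where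

      +-lsc : Lsc (λ x → h x Real.+ k x)
      +-lsc x (a , b , a∈ , b∈ , eq) =
        near-map (λ { (lift a∈′ , lift b∈′) → lift (a , b , a∈′ , b∈′ , eq) })
                 (near-∩ (lsc H x a∈) (lsc K x b∈))

      +-usc : Usc (λ x → h x Real.+ k x)
      +-usc x {b} (t , t∉ , t<b) =
        let s , t<s , s<b = ℚ.<-dense t<b
            c , d , c∉ , d∉ , c+d≡s = +-split (h x) (k x) t∉ t<s
            ε = (b ℚ.- s) ℚ.* ½
            0<ε = subst (ℚ._< ε) (ℚ.*-zeroˡ ½) (ℚ.*-monoˡ-<-pos ½ (<⇒0<- s<b))
        in near-map
             (λ { {y} (lift h<c+ε , lift k<d+ε) →
                  lift (+-< (h y) (k y) (trans (regroup c d (b ℚ.- s))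
                                          (trans (cong (ℚ._+ (b ℚ.- s)) c+d≡s) (s+[b-s] s b)))
                            h<c+ε k<d+ε) })
             (near-∩ (usc H x (c , c∉ , 0<⇒<+ c 0<ε)) (usc K x (d , d∉ , 0<⇒<+ d 0<ε)))
        where
        +-< : ∀ r s {u v b} → u ℚ.+ v ≡ b →
              r Real.< fromℚ u → s Real.< fromℚ v → r Real.+ s Real.< fromℚ b
        +-< r s refl (p , p∉r , p<u) (q , q∉s , q<v) =
          p ℚ.+ q ,
          (λ (a , b , a∈r , b∈s , eq) → ℚ.<-irrefl (sym eq)
            (ℚ.+-mono-< (Real.cut-< r a∈r p∉r) (Real.cut-< s b∈s q∉s))) ,
          ℚ.+-mono-< p<u q<v
        regroup : ∀ c d e → (c ℚ.+ e ℚ.* ½) ℚ.+ (d ℚ.+ e ℚ.* ½) ≡ (c ℚ.+ d) ℚ.+ e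
        regroup c d e = trans (reorder c d (e ℚ.* ½)) (cong (c ℚ.+ d ℚ.+_) (double-½ e))
          where
          reorder : ∀ c d e → (c ℚ.+ e) ℚ.+ (d ℚ.+ e) ≡ (c ℚ.+ d) ℚ.+ (e ℚ.+ e)
          reorder = solve 3 (λ c d e → (c :+ e) :+ (d :+ e) := (c :+ d) :+ (e :+ e)) refl
            where open +-*-Solver
        s+[b-s] : ∀ s b → s ℚ.+ (b ℚ.- s) ≡ b
        s+[b-s] = solve 2 (λ s b → s :+ (b :- s) := b) refl where open +-*-Solver

      ∧-lsc : Lsc (λ x → h x Real.∧ k x)
      ∧-lsc x (a∈h , a∈k) =
        near-map (λ (lift u , lift v) → lift (u , v)) (near-∩ (lsc H x a∈h) (lsc K x a∈k))

      ∧-usc : Usc (λ x → h x Real.∧ k x)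
      ∧-usc x (t , t∉ , t<b) with em {P = t ∈ cut (h x)}
      ... | no t∉h  = near-map (λ (lift (s , s∉ , s<b)) → lift (s , s∉ ∘ proj₁ , s<b))
                        (usc H x (t , t∉h , t<b))
      ... | yes t∈h = near-map (λ (lift (s , s∉ , s<b)) → lift (s , s∉ ∘ proj₂ , s<b))
                        (usc K x (t , (λ t∈k → t∉ (t∈h , t∈k)) , t<b))

      ∨-lsc : Lsc (λ x → h x Real.∨ k x)
      ∨-lsc x (inj₁ a∈h) = near-map (λ (lift u) → lift (inj₁ u)) (lsc H x a∈h)
      ∨-lsc x (inj₂ a∈k) = near-map (λ (lift u) → lift (inj₂ u)) (lsc K x a∈k)

      ∨-usc : Usc (λ x → h x Real.∨ k x)
      ∨-usc x (t , t∉ , t<b) =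
        near-map (λ { {y} (lift u , lift v) → lift (∨-< (h y) (k y) u v) })
          (near-∩ (usc H x (t , t∉ ∘ inj₁ , t<b)) (usc K x (t , t∉ ∘ inj₂ , t<b)))
        where
        ∨-< : ∀ r s {b} → r Real.< fromℚ b → s Real.< fromℚ b → r Real.∨ s Real.< fromℚ b
        ∨-< r s (p , p∉r , p<b) (q , q∉s , q<b) with ℚ.≤-total p q
        ... | inj₁ p≤q = q , [ (λ q∈r → ℚ.<-irrefl refl (ℚ.≤-<-trans p≤q (Real.cut-< r q∈r p∉r)))
                             , q∉s ]′ , q<b
        ... | inj₂ q≤p = p , [ p∉r
                             , (λ p∈s → ℚ.<-irrefl refl (ℚ.≤-<-trans q≤p (Real.cut-< s p∈s q∉s)))
                             ]′ , p<b

      +-cts : Cts (λ x → h x Real.+ k x)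
      +-cts = cts +-lsc +-usc

      ∧-cts : Cts (λ x → h x Real.∧ k x)
      ∧-cts = cts ∧-lsc ∧-usc

      ∨-cts : Cts (λ x → h x Real.∨ k x)
      ∨-cts = cts ∨-lsc ∨-usc

    C↗-setoid : Setoid (1ℓ ⊔ lsuc ℓ) ℓ
    C↗-setoid = record
      { Carrier       = C↗Map
      ; _≈_           = λ f g → ∀ x → fun f x Interval.≈ fun g x
      ; isEquivalence = record
        { refl  = λ {f} x → Setoid.refl Interval.setoid {fun f x}
        ; sym   = λ {f} {g} h x → Setoid.sym Interval.setoid {fun f x} {fun g x} (h x)
        ; trans = λ {f} {g} {k} h h′ x →
                    Setoid.trans Interval.setoid {fun f x} {fun g x} {fun k x} (h x) (h′ x)
        }
      }

    C↗ : RawMCAlgebra (1ℓ ⊔ lsuc ℓ) ℓ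
    C↗ = record
      { setoid = C↗-setoid
      ; _∨_    = λ f g → record
        { fun        = λ x → fun f x Interval.∨ fun g x
        ; continuous = cts⇒continuous _ (∨-cts (fun-cts f) (fun-cts g))
        ; monotone   = λ x≤y → [ inj₁ ∘ monotone f x≤y , inj₂ ∘ monotone g x≤y ]′
        }
      ; _∧_    = λ f g → record
        { fun        = λ x → fun f x Interval.∧ fun g x
        ; continuous = cts⇒continuous _ (∧-cts (fun-cts f) (fun-cts g))
        ; monotone   = λ x≤y (h , k) → monotone f x≤y h , monotone g x≤y k
        }
      ; _∔_    = λ f g → record
        { fun        = λ x → fun f x Interval.∔ fun g x
        ; continuous = cts⇒continuous _
            (∧-cts (+-cts (fun-cts f) (fun-cts g)) (const-cts Real.1ℝ))
        ; monotone   = λ x≤y ((a , b , a∈ , b∈ , eq) , q<1) →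
            (a , b , monotone f x≤y a∈ , monotone g x≤y b∈ , eq) , q<1
        }
      ; _⊙_    = λ f g → record
        { fun        = λ x → fun f x Interval.⊙ fun g x
        ; continuous = cts⇒continuous _
            (∨-cts (+-cts (+-cts (fun-cts f) (fun-cts g)) (const-cts Real.-1ℝ))
                   (const-cts Real.0ℝ))
        ; monotone   = λ { x≤y (inj₂ q<0) → inj₂ q<0
                         ; x≤y (inj₁ (_ , c , (a , b , a∈ , b∈ , refl) , c∈ , eq)) →
                             inj₁ (_ , c , (a , b , monotone f x≤y a∈ , monotone g x≤y b∈ , refl)
                                  , c∈ , eq) }
        }
      ; const  = λ c → record
        { fun        = λ _ → c
        ; continuous = cts⇒continuous _ (const-cts (val c))
        ; monotone   = λ _ h → h
        }
      }

  -- The duality makes X = Sp(A) unique up to isomorphism of ordered spaces.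
  _IsSpectrumOf_ : ∀ {a e ℓ} → CompactOrderedSpace ℓ → RawMCAlgebra a e → Set _
  X IsSpectrumOf A = A ≅ C↗ X

{-# OPTIONS --safe #-}

-- For b in B, the map equal to b on ]0,1] and its counterpart for ¬ b are
-- complementary in USC(B).  Their images in C↗(X) are non-decreasing and
-- complementary, so each takes equal values at x and y when x ≤ y.  For b = f(r)
-- the first map h satisfies h ∧ r ≤ f ≤ h ∨ r; letting r vary, every function in
-- C↗(X) is therefore non-increasing.  By Nachbin's ordered Urysohn lemma these
-- functions reflect the order, hence x ≤ y implies y ≤ x.

module Submission where

open import Axiom.ExcludedMiddle using (ExcludedMiddle)
open import Data.Empty using (⊥-elim)
open import Data.List.Base using ([]; _∷_)
open import Data.List.Relation.Unary.Any using (Any; here; there)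
open import Data.Maybe.Base using (Maybe; just; nothing)
open import Data.Nat.Base as ℕ using (ℕ; zero; suc; _^_)
import Data.Nat.Properties as ℕ
open import Data.Nat.Solver using () renaming (module +-*-Solver to ℕ-Solver)
open import Data.Product.Base using (∃; _×_; _,_; proj₁; proj₂)
open import Data.Rational.Base as ℚ using (ℚ; 0ℚ; 1ℚ; ½)
import Data.Rational.Properties as ℚ
open import Data.Rational.Solver using () renaming (module +-*-Solver to ℚ-Solver)
open import Data.Sum.Base using (inj₁; inj₂; [_,_]′)
open import Function.Base using (_∘_; flip)
open import Function.Bundles using (_⇔_; mk⇔; Bijection)
open import Level using (Level; Lift; lift) renaming (suc to lsuc)
open import Relation.Binary using (Rel)
import Relation.Binary.Lattice.Properties.HeytingAlgebra as HeytingAlgebraProperties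
open import Relation.Binary.PropositionalEquality
  using (_≡_; refl; sym; trans; cong; subst; subst₂)
open import Relation.Nullary using (¬_; yes; no)
open import Relation.Unary using (Pred; _∈_; _∉_; _⊆_; _∩_; _∪_; ∁)
open import Relation.Unary.Polymorphic using (U; ∅)
open import Defs
open Rational

-- Dyadic rationals k / 2 ^ n, written k · ε n

ε : ℕ → ℚ
ε zero    = 1ℚ
ε (suc n) = ε n ℚ.* ½

0≤ε : ∀ n → 0ℚ ℚ.≤ ε n
0≤ε zero    = ℚ.nonNegative⁻¹ 1ℚ
0≤ε (suc n) = subst (ℚ._≤ ε n ℚ.* ½) (ℚ.*-zeroˡ ½) (ℚ.*-monoʳ-≤-nonNeg ½ (0≤ε n))

·-distribʳ-+ : ∀ p j k → (j ℕ.+ k) · p ≡ j · p ℚ.+ k · p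
·-distribʳ-+ p zero    k = sym (ℚ.+-identityˡ (k · p))
·-distribʳ-+ p (suc j) k = trans (cong (ℚ._+ p) (·-distribʳ-+ p j k))
  (solve 3 (λ a b c → a :+ b :+ c := a :+ c :+ b) refl (j · p) (k · p) p)
  where open ℚ-Solver

·-monoˡ-≤ : ∀ {p k l} → 0ℚ ℚ.≤ p → k ℕ.≤ l → k · p ℚ.≤ l · p
·-monoˡ-≤ {l = zero}  0≤p ℕ.z≤n = ℚ.≤-refl
·-monoˡ-≤ {p} {l = suc l} 0≤p ℕ.z≤n = ℚ.+-mono-≤ (·-monoˡ-≤ {l = l} 0≤p ℕ.z≤n) 0≤p
·-monoˡ-≤ {p} 0≤p (ℕ.s≤s k≤l) = ℚ.+-monoˡ-≤ p (·-monoˡ-≤ 0≤p k≤l)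

2*-·-ε : ∀ k n → (2 ℕ.* k) · ε (suc n) ≡ k · ε n
2*-·-ε k n = trans (·-distribʳ-+ (ε (suc n)) k (k ℕ.+ 0))
  (trans (cong (λ j → k · ε (suc n) ℚ.+ j · ε (suc n)) (ℕ.+-identityʳ k))
    (trans (cong (λ p → p ℚ.+ p) halved) (double-½ (k · ε n))))
  where
  halved : k · ε (suc n) ≡ k · ε n ℚ.* ½
  halved = trans (·-* k (ε (suc n)))
    (trans (sym (ℚ.*-assoc (k · 1ℚ) (ε n) ½)) (cong (ℚ._* ½) (sym (·-* k (ε n)))))

scale-·-ε : ∀ k m n → (k ℕ.* 2 ^ m) · ε (m ℕ.+ n) ≡ k · ε n
scale-·-ε k zero    n = cong (_· ε n) (ℕ.*-identityʳ k)
scale-·-ε k (suc m) n = trans (cong (_· ε (suc m ℕ.+ n)) (swap k (2 ^ m)))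
  (trans (2*-·-ε (k ℕ.* 2 ^ m) (m ℕ.+ n)) (scale-·-ε k m n))
  where
  swap : ∀ k l → k ℕ.* (2 ℕ.* l) ≡ 2 ℕ.* (k ℕ.* l)
  swap = solve 2 (λ k l → k :* (con 2 :* l) := con 2 :* (k :* l)) refl
    where open ℕ-Solver

-- Cross-multiplication: both sides are rewritten over the common denominator `2 ^ (m + n)`.
·-ε-≤ : ∀ k l m n → k ℕ.* 2 ^ m ℕ.≤ l ℕ.* 2 ^ n → k · ε n ℚ.≤ l · ε m
·-ε-≤ k l m n h = subst₂ ℚ._≤_ (scale-·-ε k m n)
  (trans (cong (λ s → (l ℕ.* 2 ^ n) · ε s) (ℕ.+-comm m n)) (scale-·-ε l n m))
  (·-monoˡ-≤ (0≤ε (m ℕ.+ n)) h)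

2^n·εn : ∀ n → 2 ^ n · ε n ≡ 1ℚ
2^n·εn zero    = refl
2^n·εn (suc n) = trans (2*-·-ε (2 ^ n) n) (2^n·εn n)

n≤2^n : ∀ n → n ℕ.≤ 2 ^ n
n≤2^n zero    = ℕ.z≤n
n≤2^n (suc n) = ℕ.+-mono-≤ (ℕ.m^n>0 2 n) (ℕ.≤-trans (n≤2^n n) (ℕ.m≤m+n (2 ^ n) 0))

-- From `1 ≤ n · δ ≤ 2 ^ n · δ`, multiplication by `ε n` gives the bound.
ε-small : ∀ {δ} → 0ℚ ℚ.< δ → ∃ λ n → ε n ℚ.≤ δ
ε-small {δ} 0<δ =
  let n , 1≤nδ = archimedean 1ℚ 0<δ
      1≤2^nδ = ℚ.≤-trans 1≤nδ (·-monoˡ-≤ (ℚ.<⇒≤ 0<δ) (n≤2^n n))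
  in n , subst₂ ℚ._≤_ (ℚ.*-identityˡ (ε n)) (collapse n)
           (ℚ.*-monoʳ-≤-nonNeg (ε n) {{ℚ.nonNegative (0≤ε n)}} 1≤2^nδ)
  where
  collapse : ∀ n → 2 ^ n · δ ℚ.* ε n ≡ δ
  collapse n = trans (cong (ℚ._* ε n) (·-* (2 ^ n) δ))
    (trans (reorder (2 ^ n · 1ℚ) δ (ε n))
      (trans (cong (ℚ._* δ) (trans (sym (·-* (2 ^ n) (ε n))) (2^n·εn n))) (ℚ.*-identityˡ δ)))
    where
    reorder : ∀ a b c → a ℚ.* b ℚ.* c ≡ a ℚ.* c ℚ.* b
    reorder = solve 3 (λ a b c → a :* b :* c := a :* c :* b) refl where open ℚ-Solver

-- `ceiling` exceeds `floor` below by at most two units of `ε n`; at this depth that error fits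
-- between `q` and `b`.
2·ε-gap : ∀ {q b} → q ℚ.< b → ∃ λ n → q ℚ.+ 2 · ε n ℚ.< b
2·ε-gap {q} {b} q<b =
  let r , q<r , r<b = ℚ.<-dense q<b
      δ = (r ℚ.- q) ℚ.* ½
      n , εn≤δ = ε-small (subst (ℚ._< δ) (ℚ.*-zeroˡ ½) (ℚ.*-monoˡ-<-pos ½ (<⇒0<- q<r)))
      2εn≤2δ = ℚ.+-mono-≤ (subst (ℚ._≤ δ) (sym (ℚ.+-identityˡ (ε n))) εn≤δ) εn≤δ
  in n , ℚ.≤-<-trans (ℚ.+-monoʳ-≤ q 2εn≤2δ)
           (subst (ℚ._< b) (sym (trans (cong (q ℚ.+_) (double-½ (r ℚ.- q))) (q+[r-q] q r))) r<b)
  where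
  q+[r-q] : ∀ q r → q ℚ.+ (r ℚ.- q) ≡ r
  q+[r-q] = solve 2 (λ q r → q :+ (r :- q) := r) refl where open ℚ-Solver

2^n+2^n : ∀ n → 2 ^ n ℕ.+ 2 ^ n ≡ 2 ^ suc n
2^n+2^n n = cong (2 ^ n ℕ.+_) (sym (ℕ.+-identityʳ (2 ^ n)))

module Spectrum (em : ∀ {ℓ} → ExcludedMiddle ℓ) where
  open Classical em

  module _ {ℓ : Level} (X : CompactOrderedSpace ℓ) where

    private
      module X = CompactOrderedSpace X
      open X using () renaming (Carrier to |X|)

    -- Separation by open sets in a compact ordered space

    ∅-open : X.IsOpen ∅
    ∅-open = near-open X λ _ ()

    ∪-open : ∀ {V W} → X.IsOpen V → X.IsOpen W → X.IsOpen (V ∪ W)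
    ∪-open {V} {W} V-open W-open = near-open X λ _ →
      [ (λ x∈V → V , V-open , x∈V , inj₁) , (λ x∈W → W , W-open , x∈W , inj₂) ]′

    ∁-closed : ∀ {V} → X.IsOpen V → X.IsClosed (∁ V)
    ∁-closed {V} = X.IsOpen-≐ ((λ x∈V x∉V → x∉V x∈V) , stable)
      where
      stable : ∁ (∁ V) ⊆ V
      stable {x} ¬¬x∈V with em {P = x ∈ V}
      ... | yes x∈V = x∈V
      ... | no  x∉V = ⊥-elim (¬¬x∈V x∉V)

    -- `R` is arbitrary so that `flip` exchanges the two sides: the compactness argument is carried
    -- out only on the left.
    record Separated (R : Rel |X| ℓ) (P Q : Pred |X| ℓ) : Set (lsuc ℓ) where
      field
        left right : Pred |X| ℓ
        left-open  : X.IsOpen left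
        right-open : X.IsOpen right
        ⊆left      : P ⊆ left
        ⊆right     : Q ⊆ right
        unrelated  : ∀ {x y} → x ∈ left → y ∈ right → ¬ R x y

    open Separated

    separated-⊆ : ∀ {R P P′ Q} → P′ ⊆ P → Separated R P Q → Separated R P′ Q
    separated-⊆ P′⊆P s = record
      { left       = left s
      ; right      = right s
      ; left-open  = left-open s
      ; right-open = right-open s
      ; ⊆left      = λ h → ⊆left s (P′⊆P h)
      ; ⊆right     = ⊆right s
      ; unrelated  = unrelated s
      }

    separated-flip : ∀ {R P Q} → Separated (flip R) P Q → Separated R Q P
    separated-flip s = record
      { left       = right s
      ; right      = left s
      ; left-open  = right-open s
      ; right-open = left-open s
      ; ⊆left      = ⊆right s
      ; ⊆right     = ⊆left s
      ; unrelated  = λ x∈ y∈ → unrelated s y∈ x∈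
      }

    -- The tube lemma argument: finitely many `left` sets cover `K`, and the intersection of the
    -- matching `right` sets is still open and contains `Q`.
    separated-closedˡ : ∀ {R K Q} → X.IsClosed K →
                        (∀ k → k ∈ K → Separated R (_≡ k) Q) → Separated R K Q
    separated-closedˡ {R} {K} {Q} K-closed sep =
      let is , covered = X.compact cover cover-open covers in
      separated-⊆ (λ {x} x∈K → x∈K , covered x) (finite is)
      where
      -- Compactness concerns covers of the whole space, so `nothing` indexes the complement of `K`.
      cover : Maybe (∃ K) → Pred |X| ℓ
      cover nothing          = ∁ K
      cover (just (k , k∈K)) = left (sep k k∈K)
      cover-open : ∀ i → X.IsOpen (cover i)
      cover-open nothing          = K-closed
      cover-open (just (k , k∈K)) = left-open (sep k k∈K)
      covers : ∀ x → ∃ λ i → x ∈ cover i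
      covers x with em {P = x ∈ K}
      ... | yes x∈K = just (x , x∈K) , ⊆left (sep x x∈K) refl
      ... | no  x∉K = nothing , x∉K
      -- Induction on the subcover, for the part of `K` that it covers.
      finite : ∀ is → Separated R (λ x → x ∈ K × Any (λ i → x ∈ cover i) is) Q
      finite [] = record
        { left       = ∅
        ; right      = U
        ; left-open  = ∅-open
        ; right-open = X.U-open
        ; ⊆left      = λ { (_ , ()) }
        ; ⊆right     = _
        ; unrelated  = λ { (lift ()) }
        }
      finite (nothing ∷ is) = separated-⊆
        (λ { (x∈K , here x∉K) → ⊥-elim (x∉K x∈K) ; (x∈K , there x∈is) → x∈K , x∈is })
        (finite is)
      finite (just (k , k∈K) ∷ is) = record
        { left       = left s ∪ left t
        ; right      = right s ∩ right t
        ; left-open  = ∪-open (left-open s) (left-open t)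
        ; right-open = X.∩-open (right-open s) (right-open t)
        ; ⊆left      = λ { (_ , here x∈s) → inj₁ x∈s
                         ; (x∈K , there x∈is) → inj₂ (⊆left t (x∈K , x∈is)) }
        ; ⊆right     = λ h → ⊆right s h , ⊆right t h
        ; unrelated  = λ { (inj₁ x∈s) (y∈s , _) → unrelated s x∈s y∈s
                         ; (inj₂ x∈t) (_ , y∈t) → unrelated t x∈t y∈t }
        }
        where
        s = sep k k∈K
        t = finite is

    separated-closed : ∀ {R K L} → X.IsClosed K → X.IsClosed L →
                       (∀ k l → k ∈ K → l ∈ L → Separated R (_≡ k) (_≡ l)) → Separated R K L
    separated-closed K-closed L-closed sep = separated-closedˡ K-closed λ k k∈K →
      separated-flip (separated-closedˡ L-closed λ l l∈L → separated-flip (sep k l k∈K l∈L))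

    -- The order is closed, so a basic open box around `(x , y)` lies in its complement.
    ≰-separated : ∀ {x y} → ¬ x X.≤ y → Separated X._≤_ (_≡ x) (_≡ y)
    ≰-separated {x} {y} x≰y =
      let V , W , V-open , W-open , x∈V , y∈W , V×W = X.hausdorff x y x≰y in record
      { left       = V
      ; right      = W
      ; left-open  = V-open
      ; right-open = W-open
      ; ⊆left      = λ { refl → x∈V }
      ; ⊆right     = λ { refl → y∈W }
      ; unrelated  = λ v w → V×W (v , w)
      }

    R-image : Rel |X| ℓ → Pred |X| ℓ → Pred |X| ℓ
    R-image R K y = ∃ λ k → k ∈ K × R k y

    -- A point outside the image is separated from all of `K` at once, and the `right` set is then a
    -- neighbourhood of it that misses the image.
    R-image-closed : ∀ {R K} → (∀ {x y} → ¬ R x y → Separated R (_≡ x) (_≡ y)) →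
                     X.IsClosed K → X.IsClosed (R-image R K)
    R-image-closed sep K-closed = near-open X λ y y∉ →
      let s = separated-closedˡ K-closed λ k k∈K → sep λ kRy → y∉ (k , k∈K , kRy) in
      right s , right-open s , ⊆right s refl ,
      λ z∈right (k , k∈K , kRz) → unrelated s (⊆left s k∈K) z∈right kRz

    ↑_ ↓_ : Pred |X| ℓ → Pred |X| ℓ
    ↑_ = R-image X._≤_
    ↓_ = R-image (flip X._≤_)

    ↑-closed : ∀ {K} → X.IsClosed K → X.IsClosed (↑ K)
    ↑-closed = R-image-closed ≰-separated

    ↓-closed : ∀ {K} → X.IsClosed K → X.IsClosed (↓ K)
    ↓-closed = R-image-closed λ x≱y → separated-flip (≰-separated x≱y)

    Upper : Pred |X| ℓ → Set ℓ
    Upper P = ∀ {x y} → x X.≤ y → x ∈ P → y ∈ P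

    -- Nachbin's ordered Urysohn lemma

    record Gap : Set (lsuc ℓ) where
      field
        inner outer  : Pred |X| ℓ
        inner-closed : X.IsClosed inner
        inner-upper  : Upper inner
        outer-open   : X.IsOpen outer
        outer-upper  : Upper outer
        inner⊆outer  : inner ⊆ outer

    open Gap

    -- Two nested sets instead of one: `inner` with `lower`, and `upper` with `outer`, must again be
    -- gaps, so the first pair needs an open set and the second a closed one.
    record Interpolant (g : Gap) : Set (lsuc ℓ) where
      field
        lower upper  : Pred |X| ℓ
        lower-open   : X.IsOpen lower
        lower-upper  : Upper lower
        upper-closed : X.IsClosed upper
        upper-upper  : Upper upper
        inner⊆lower  : inner g ⊆ lower
        lower⊆upper  : lower ⊆ upper
        upper⊆outer  : upper ⊆ outer g

    open Interpolant

    -- The separating sets need not be upper: `lower` is the largest upper set inside `left`, and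
    -- `upper` the smallest one containing the complement of `right`.
    interpolate : ∀ g → Interpolant g
    interpolate g = record
      { lower        = ∁ (↓ ∁ (left s))
      ; upper        = ↑ ∁ (right s)
      ; lower-open   = ↓-closed (∁-closed (left-open s))
      ; lower-upper  = λ x≤y x∉ (k , k∉ , y≤k) → x∉ (k , k∉ , X.trans x≤y y≤k)
      ; upper-closed = ↑-closed (∁-closed (right-open s))
      ; upper-upper  = λ x≤y (k , k∉ , k≤x) → k , k∉ , X.trans k≤x x≤y
      ; inner⊆lower  = λ x∈ (k , k∉ , x≤k) → k∉ (⊆left s (inner-upper g x≤k x∈))
      ; lower⊆upper  = middle
      ; upper⊆outer  = in-outer
      }
      where
      s : Separated X._≤_ (inner g) (∁ (outer g))
      s = separated-closed (inner-closed g) (∁-closed (outer-open g)) λ x y x∈ y∉ →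
        ≰-separated λ x≤y → y∉ (outer-upper g x≤y (inner⊆outer g x∈))
      middle : ∁ (↓ ∁ (left s)) ⊆ ↑ ∁ (right s)
      middle {x} x∉ with em {P = x ∈ right s} | em {P = x ∈ left s}
      ... | no  x∉r | _       = x , x∉r , X.refl
      ... | yes x∈r | no  x∉l = ⊥-elim (x∉ (x , x∉l , X.refl))
      ... | yes x∈r | yes x∈l = ⊥-elim (unrelated s x∈l x∈r X.refl)
      in-outer : ↑ ∁ (right s) ⊆ outer g
      in-outer {x} (k , k∉ , k≤x) with em {P = k ∈ outer g}
      ... | yes k∈ = outer-upper g k≤x k∈
      ... | no k∉o = ⊥-elim (k∉ (⊆right s k∉o))

    -- The Urysohn function will be at least `½` on `lower` and at most `½` off `upper`; each half
    -- is the gap that determines the remaining digits.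
    upperHalf lowerHalf : Gap → Gap
    upperHalf g = record
      { inner        = inner g
      ; outer        = lower i
      ; inner-closed = inner-closed g
      ; inner-upper  = inner-upper g
      ; outer-open   = lower-open i
      ; outer-upper  = lower-upper i
      ; inner⊆outer  = inner⊆lower i
      }
      where i = interpolate g
    lowerHalf g = record
      { inner        = upper i
      ; outer        = outer g
      ; inner-closed = upper-closed i
      ; inner-upper  = upper-upper i
      ; outer-open   = outer-open g
      ; outer-upper  = outer-upper g
      ; inner⊆outer  = upper⊆outer i
      }
      where i = interpolate g

    -- Binary expansion of a Urysohn function of g, equal to 1 on inner g and to 0
    -- off outer g: its value at x lies between floor n g x / 2 ^ n and
    -- ceiling n g x / 2 ^ n.
    floor ceiling : ℕ → Gap → |X| → ℕ
    floor zero    g x = 0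
    floor (suc n) g x with em {P = x ∈ lower (interpolate g)}
    ... | yes _ = 2 ^ n ℕ.+ floor n (upperHalf g) x
    ... | no  _ = floor n (lowerHalf g) x
    ceiling zero    g x = 1
    ceiling (suc n) g x with em {P = x ∈ upper (interpolate g)}
    ... | yes _ = 2 ^ n ℕ.+ ceiling n (upperHalf g) x
    ... | no  _ = ceiling n (lowerHalf g) x

    floor≤2^n : ∀ n g x → floor n g x ℕ.≤ 2 ^ n
    floor≤2^n zero    g x = ℕ.z≤n
    floor≤2^n (suc n) g x with em {P = x ∈ lower (interpolate g)}
    ... | yes _ = subst (2 ^ n ℕ.+ floor n (upperHalf g) x ℕ.≤_) (2^n+2^n n)
                    (ℕ.+-monoʳ-≤ (2 ^ n) (floor≤2^n n (upperHalf g) x))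
    ... | no  _ = ℕ.≤-trans (floor≤2^n n (lowerHalf g) x) (ℕ.m≤m+n (2 ^ n) _)

    ceiling≤2^n : ∀ n g x → ceiling n g x ℕ.≤ 2 ^ n
    ceiling≤2^n zero    g x = ℕ.≤-refl
    ceiling≤2^n (suc n) g x with em {P = x ∈ upper (interpolate g)}
    ... | yes _ = subst (2 ^ n ℕ.+ ceiling n (upperHalf g) x ℕ.≤_) (2^n+2^n n)
                    (ℕ.+-monoʳ-≤ (2 ^ n) (ceiling≤2^n n (upperHalf g) x))
    ... | no  _ = ℕ.≤-trans (ceiling≤2^n n (lowerHalf g) x) (ℕ.m≤m+n (2 ^ n) _)

    -- All `n` digits are 1 on `inner`, but depth zero contributes 0, hence the off-by-one.
    floor-inner : ∀ n g {x} → x ∈ inner g → 2 ^ n ℕ.≤ suc (floor n g x)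
    floor-inner zero    g x∈ = ℕ.≤-refl
    floor-inner (suc n) g {x} x∈ with em {P = x ∈ lower (interpolate g)}
    ... | yes _  = subst₂ ℕ._≤_ (2^n+2^n n) (ℕ.+-suc (2 ^ n) _)
                     (ℕ.+-monoʳ-≤ (2 ^ n) (floor-inner n (upperHalf g) x∈))
    ... | no  x∉ = ⊥-elim (x∉ (inner⊆lower (interpolate g) x∈))

    floor-outer : ∀ n g {x} → x ∉ outer g → floor n g x ≡ 0
    floor-outer zero    g x∉ = refl
    floor-outer (suc n) g {x} x∉ with em {P = x ∈ lower (interpolate g)}
    ... | yes x∈ = ⊥-elim (x∉ (upper⊆outer (interpolate g) (lower⊆upper (interpolate g) x∈)))
    ... | no  _  = floor-outer n (lowerHalf g) x∉

    -- Dually, all digits are 0 off `outer`, but depth zero contributes 1.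
    ceiling-outer : ∀ n g {x} → x ∉ outer g → ceiling n g x ℕ.≤ 1
    ceiling-outer zero    g x∉ = ℕ.≤-refl
    ceiling-outer (suc n) g {x} x∉ with em {P = x ∈ upper (interpolate g)}
    ... | yes x∈ = ⊥-elim (x∉ (upper⊆outer (interpolate g) x∈))
    ... | no  _  = ceiling-outer n (lowerHalf g) x∉

    ceiling≤floor+2 : ∀ n g x → ceiling n g x ℕ.≤ floor n g x ℕ.+ 2
    ceiling≤floor+2 zero    g x = ℕ.s≤s ℕ.z≤n
    ceiling≤floor+2 (suc n) g x
      with em {P = x ∈ lower (interpolate g)} | em {P = x ∈ upper (interpolate g)}
    ... | yes _  | yes _  = subst (2 ^ n ℕ.+ ceiling n (upperHalf g) x ℕ.≤_)
                              (sym (ℕ.+-assoc (2 ^ n) (floor n (upperHalf g) x) 2))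
                              (ℕ.+-monoʳ-≤ (2 ^ n) (ceiling≤floor+2 n (upperHalf g) x))
    ... | yes x∈ | no  x∉ = ⊥-elim (x∉ (lower⊆upper (interpolate g) x∈))
    -- Between `lower` and `upper` the leading digits differ: `floor` is at least `2 ^ n - 1`, as
    -- `x` is in the inner set of the lower half, and `ceiling` at most `2 ^ n + 1`, as `x` is off
    -- the outer set of the upper half.
    ... | no  x∉ | yes x∈ = subst (2 ^ n ℕ.+ ceiling n (upperHalf g) x ℕ.≤_)
                              (sym (ℕ.+-suc (floor n (lowerHalf g) x) 1))
                              (ℕ.+-mono-≤ (floor-inner n (lowerHalf g) x∈)
                                          (ceiling-outer n (upperHalf g) x∉))
    ... | no  _  | no  _  = ceiling≤floor+2 n (lowerHalf g) x

    -- The depths may differ, so that a single ceiling bounds all floors and hence their supremum.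
    floor≤ceiling : ∀ n m g x → floor n g x ℕ.* 2 ^ m ℕ.≤ ceiling m g x ℕ.* 2 ^ n
    floor≤ceiling zero    m    g x = ℕ.z≤n
    floor≤ceiling (suc n) zero g x =
      subst₂ ℕ._≤_ (sym (ℕ.*-identityʳ _)) (sym (ℕ.*-identityˡ _)) (floor≤2^n (suc n) g x)
    floor≤ceiling (suc n) (suc m) g x
      with em {P = x ∈ lower (interpolate g)} | em {P = x ∈ upper (interpolate g)}
    ... | yes _  | yes _  =
      subst₂ ℕ._≤_ (sym (expandˡ (2 ^ n) (floor n (upperHalf g) x) (2 ^ m)))
        (sym (expandʳ (2 ^ m) (ceiling m (upperHalf g) x) (2 ^ n)))
        (ℕ.*-monoʳ-≤ 2 (ℕ.+-monoʳ-≤ (2 ^ n ℕ.* 2 ^ m) (floor≤ceiling n m (upperHalf g) x)))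
      where
      open ℕ-Solver
      expandˡ : ∀ b s a → (b ℕ.+ s) ℕ.* (2 ℕ.* a) ≡ 2 ℕ.* (b ℕ.* a ℕ.+ s ℕ.* a)
      expandˡ = solve 3 (λ b s a → (b :+ s) :* (con 2 :* a) := con 2 :* (b :* a :+ s :* a)) refl
      expandʳ : ∀ a t b → (a ℕ.+ t) ℕ.* (2 ℕ.* b) ≡ 2 ℕ.* (b ℕ.* a ℕ.+ t ℕ.* b)
      expandʳ = solve 3 (λ a t b → (a :+ t) :* (con 2 :* b) := con 2 :* (b :* a :+ t :* b)) refl
    ... | yes x∈ | no  x∉ = ⊥-elim (x∉ (lower⊆upper (interpolate g) x∈))
    -- The leading digit is 0 for `floor` and 1 for `ceiling`, so `½` lies between the two values.
    ... | no  _  | yes _  = ℕ.≤-trans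
      (ℕ.*-monoˡ-≤ (2 ^ suc m) (floor≤2^n n (lowerHalf g) x))
      (subst (ℕ._≤ (2 ^ m ℕ.+ ceiling m (upperHalf g) x) ℕ.* 2 ^ suc n) (swap (2 ^ m) (2 ^ n))
        (ℕ.*-monoˡ-≤ (2 ^ suc n) (ℕ.m≤m+n (2 ^ m) _)))
      where
      swap : ∀ a b → a ℕ.* (2 ℕ.* b) ≡ b ℕ.* (2 ℕ.* a)
      swap = solve 2 (λ a b → a :* (con 2 :* b) := b :* (con 2 :* a)) refl
        where open ℕ-Solver
    ... | no  _  | no  _  =
      subst₂ ℕ._≤_ (swap (floor n (lowerHalf g) x) (2 ^ m))
        (swap (ceiling m (lowerHalf g) x) (2 ^ n))
        (ℕ.*-monoʳ-≤ 2 (floor≤ceiling n m (lowerHalf g) x))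
      where
      swap : ∀ k l → 2 ℕ.* (k ℕ.* l) ≡ k ℕ.* (2 ℕ.* l)
      swap = solve 2 (λ k l → con 2 :* (k :* l) := k :* (con 2 :* l)) refl
        where open ℕ-Solver

    floor-upperHalf : ∀ n g {x} → x ∈ lower (interpolate g) →
                      2 ^ n ℕ.+ floor n (upperHalf g) x ℕ.≤ floor (suc n) g x
    floor-upperHalf n g {x} x∈ with em {P = x ∈ lower (interpolate g)}
    ... | yes _  = ℕ.≤-refl
    ... | no  x∉ = ⊥-elim (x∉ x∈)

    -- Membership in `lower` does not matter, since this floor never exceeds `2 ^ n`. Thus a digit 0
    -- at one point puts no condition on the first digit at larger or nearby points.
    floor-lowerHalf : ∀ n g x → floor n (lowerHalf g) x ℕ.≤ floor (suc n) g x
    floor-lowerHalf n g x with em {P = x ∈ lower (interpolate g)}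
    ... | yes _ = ℕ.≤-trans (floor≤2^n n (lowerHalf g) x) (ℕ.m≤m+n (2 ^ n) _)
    ... | no  _ = ℕ.≤-refl

    ceiling-upperHalf : ∀ n g x → ceiling (suc n) g x ℕ.≤ 2 ^ n ℕ.+ ceiling n (upperHalf g) x
    ceiling-upperHalf n g x with em {P = x ∈ upper (interpolate g)}
    ... | yes _ = ℕ.≤-refl
    ... | no  _ = ℕ.≤-trans (ceiling≤2^n n (lowerHalf g) x) (ℕ.m≤m+n (2 ^ n) _)

    ceiling-lowerHalf : ∀ n g {x} → x ∉ upper (interpolate g) →
                        ceiling (suc n) g x ℕ.≤ ceiling n (lowerHalf g) x
    ceiling-lowerHalf n g {x} x∉ with em {P = x ∈ upper (interpolate g)}
    ... | yes x∈ = ⊥-elim (x∉ x∈)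
    ... | no  _  = ℕ.≤-refl

    floor-mono : ∀ n g {x y} → x X.≤ y → floor n g x ℕ.≤ floor n g y
    floor-mono zero    g x≤y = ℕ.z≤n
    floor-mono (suc n) g {x} {y} x≤y with em {P = x ∈ lower (interpolate g)}
    ... | yes x∈ = ℕ.≤-trans (ℕ.+-monoʳ-≤ (2 ^ n) (floor-mono n (upperHalf g) x≤y))
                     (floor-upperHalf n g (lower-upper (interpolate g) x≤y x∈))
    ... | no  _  = ℕ.≤-trans (floor-mono n (lowerHalf g) x≤y) (floor-lowerHalf n g y)

    -- A digit 1 of `floor` is membership in an open set, so it persists nearby; a digit 0 can only
    -- be raised.
    floor-near : ∀ n g x → Near X x λ y → Lift ℓ (floor n g x ℕ.≤ floor n g y)
    floor-near zero    g x = near-U X λ _ → lift ℕ.z≤n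
    floor-near (suc n) g x with em {P = x ∈ lower (interpolate g)}
    ... | yes x∈ = near-map X
      (λ { (y∈ , lift h) → lift (ℕ.≤-trans (ℕ.+-monoʳ-≤ (2 ^ n) h) (floor-upperHalf n g y∈)) })
      (near-∩ X (lower i , lower-open i , x∈ , λ h → h) (floor-near n (upperHalf g) x))
      where i = interpolate g
    ... | no  _  = near-map X
      (λ { {y} (lift h) → lift (ℕ.≤-trans h (floor-lowerHalf n g y)) })
      (floor-near n (lowerHalf g) x)

    -- Dually, a digit 0 of `ceiling` is membership in the complement of a closed set.
    ceiling-near : ∀ n g x → Near X x λ y → Lift ℓ (ceiling n g y ℕ.≤ ceiling n g x)
    ceiling-near zero    g x = near-U X λ _ → lift ℕ.≤-refl
    ceiling-near (suc n) g x with em {P = x ∈ upper (interpolate g)}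
    ... | yes _  = near-map X
      (λ { {y} (lift h) → lift (ℕ.≤-trans (ceiling-upperHalf n g y) (ℕ.+-monoʳ-≤ (2 ^ n) h)) })
      (ceiling-near n (upperHalf g) x)
    ... | no  x∉ = near-map X
      (λ { (y∉ , lift h) → lift (ℕ.≤-trans (ceiling-lowerHalf n g y∉) h) })
      (near-∩ X (∁ (upper i) , upper-closed i , x∉ , λ h → h) (ceiling-near n (lowerHalf g) x))
      where i = interpolate g

    -- The supremum over all depths of the dyadic values of `floor`, as a lower cut; the strict
    -- inequality makes the cut rounded.
    urysohnValue : Gap → |X| → 𝕀
    urysohnValue g x = record
      { val    = record
        { cut       = λ q → ∃ λ n → q ℚ.< floor n g x · ε n
        ; inhabited = ℚ.- 1ℚ , 0 , ℚ.negative⁻¹ (ℚ.- 1ℚ)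
        ; bounded   = 1ℚ , λ (n , 1<) → ℚ.<-irrefl refl (ℚ.<-≤-trans 1< (≤1ℚ n))
        ; downward  = λ p<q (n , q<) → n , ℚ.<-trans p<q q<
        ; rounded   = λ (n , q<) → let r , q<r , r< = ℚ.<-dense q< in r , q<r , n , r<
        }
      ; nonNeg = λ q<0 → 0 , q<0
      ; ≤1     = λ (n , q<) → ℚ.<-≤-trans q< (≤1ℚ n)
      }
      where
      ≤1ℚ : ∀ n → floor n g x · ε n ℚ.≤ 1ℚ
      ≤1ℚ n = ·-ε-≤ (floor n g x) 1 0 n (subst₂ ℕ._≤_ (sym (ℕ.*-identityʳ _)) (sym (ℕ.*-identityˡ _))
                                  (floor≤2^n n g x))

    urysohn-lsc : ∀ g → Lsc X (val ∘ urysohnValue g)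
    urysohn-lsc g x (n , a<) = near-map X
      (λ { (lift h) → lift (n , ℚ.<-≤-trans a< (·-monoˡ-≤ (0≤ε n) h)) })
      (floor-near n g x)

    -- As `q` is off the cut, every `floor` value at `x` is at most `q`, so some `ceiling` value is
    -- below `b`. That ceiling does not grow near `x`, and it bounds every `floor` there.
    urysohn-usc : ∀ g → Usc X (val ∘ urysohnValue g)
    urysohn-usc g x {b} (q , q∉ , q<b) = near-map X
      (λ { {y} (lift h) → lift (ceiling n g x · ε n ,
        (λ (m , c<) → ℚ.<-irrefl refl (ℚ.<-≤-trans c< (ℚ.≤-trans
          (·-ε-≤ (floor m g y) (ceiling n g y) n m (floor≤ceiling m n g y))
          (·-monoˡ-≤ (0≤ε n) h)))) ,
        ceiling<b) })
      (ceiling-near n g x)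
      where
      n = proj₁ (2·ε-gap q<b)
      ceiling<b : ceiling n g x · ε n ℚ.< b
      ceiling<b = ℚ.≤-<-trans
        (ℚ.≤-trans (·-monoˡ-≤ (0≤ε n) (ceiling≤floor+2 n g x))
          (subst (ℚ._≤ q ℚ.+ 2 · ε n) (sym (·-distribʳ-+ (ε n) (floor n g x) 2))
            (ℚ.+-monoˡ-≤ (2 · ε n) (ℚ.≮⇒≥ λ q< → q∉ (n , q<)))))
        (proj₂ (2·ε-gap q<b))

    urysohn : Gap → C↗Map X
    urysohn g = record
      { fun        = urysohnValue g
      ; continuous = cts⇒continuous X _ (cts (urysohn-lsc g) (urysohn-usc g))
      ; monotone   = λ x≤y (n , q<) →
          n , ℚ.<-≤-trans q< (·-monoˡ-≤ (0≤ε n) (floor-mono n g x≤y))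
      }

    -- One digit suffices: `inner` lies in `lower`, where the value is at least `½`.
    urysohn-inner : ∀ g {x} → x ∈ inner g → 0ℚ ∈ cut (val (fun (urysohn g) x))
    urysohn-inner g x∈ = 1 , ℚ.<-≤-trans (ℚ.positive⁻¹ ½)
      (·-monoˡ-≤ {k = 1} (0≤ε 1) (ℕ.≤-trans (ℕ.m≤m+n 1 _)
        (floor-upperHalf 0 g (inner⊆lower (interpolate g) x∈))))

    urysohn-outer : ∀ g {x} → x ∉ outer g → 0ℚ ∉ cut (val (fun (urysohn g) x))
    urysohn-outer g x∉ (n , 0<) =
      ℚ.<-irrefl refl (subst (λ k → 0ℚ ℚ.< k · ε n) (floor-outer n g x∉) 0<)

    -- The Urysohn function of this gap is positive at `y` and zero at `x`.
    principalGap : ∀ {x y} → ¬ y X.≤ x → Gap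
    principalGap {x} {y} y≰x = record
      { inner        = y X.≤_
      ; outer        = λ z → ¬ z X.≤ x
      ; inner-closed = near-open X λ z y≰z →
          let s = ≰-separated y≰z in
          right s , right-open s , ⊆right s refl , λ w → unrelated s (⊆left s refl) w
      ; inner-upper  = λ z≤w y≤z → X.trans y≤z z≤w
      ; outer-open   = near-open X λ z z≰x →
          let s = ≰-separated z≰x in
          left s , left-open s , ⊆left s refl , λ w → unrelated s w (⊆right s refl)
      ; outer-upper  = λ z≤w z≰x w≤x → z≰x (X.trans z≤w w≤x)
      ; inner⊆outer  = λ y≤z z≤x → y≰x (X.trans y≤z z≤x)
      }

    C↗-reflects-≤ : ∀ {x y} → (∀ (f : C↗Map X) → fun f y Interval.≤ fun f x) → y X.≤ x
    C↗-reflects-≤ {x} {y} h with em {P = y X.≤ x}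
    ... | yes y≤x = y≤x
    ... | no  y≰x = ⊥-elim (urysohn-outer g (λ x≰x → x≰x X.refl)
                      (h (urysohn g) (urysohn-inner g X.refl)))
      where g = principalGap y≰x

  module _ {c ℓ₁ ℓ₂ : Level} (B : CompleteBooleanAlgebra c ℓ₁ ℓ₂) where

    -- Non-decreasing functions on the spectrum of USC(B)

    private
      module B = CompleteBooleanAlgebra B
      open B using (⊤; ⊥) renaming (Carrier to |B|)
      open HeytingAlgebraProperties B.heytingAlgebra using (⇨-unit)
    open Interval using (_≤_; _<_; 0𝕀; 1𝕀)

    -- Such a `q` is the supremum of the empty set.
    app-≮0 : ∀ (f : USCMap B) {q} → ¬ 0𝕀 < q → app f q B.≤ ⊥
    app-≮0 f {q} 0≮q = app-least B f ∅ q ((λ ()) , least) λ { _ (lift ()) }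
      where
      least : ∀ u → _ → q ≤ u
      least u _ {t} t∈q = nonNeg u (ℚ.≰⇒> λ 0≤t → 0≮q
        (t , (λ t<0 → ℚ.<-irrefl refl (ℚ.<-≤-trans t<0 0≤t)) , t∈q))

    -- Under USC(B) ≅ C↗(X), the characteristic function of a clopen set on whose
    -- complement b holds.
    indicator : |B| → USCMap B
    indicator b = value ,ₛ mk-sup-pres B value mono least
      where
      value : 𝕀 → |B|
      value q with em {P = 0𝕀 < q}
      ... | yes _ = b
      ... | no  _ = ⊥
      mono : ∀ p q → p ≤ q → value p B.≤ value q
      mono p q p≤q with em {P = 0𝕀 < p} | em {P = 0𝕀 < q}
      ... | no _    | _      = B.minimum _
      ... | yes _   | yes _  = B.refl
      ... | yes 0<p | no 0≮q = ⊥-elim (0≮q (Real.<-≤-trans {Real.0ℝ} {val p} {val q} 0<p p≤q))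
      least : ∀ S s u → IsLub _≤_ S s → (∀ q → q ∈ S → value q B.≤ u) → value s B.≤ u
      least S s u lub ub with em {P = 0𝕀 < s}
      ... | no _    = B.minimum _
      ... | yes 0<s with lub-< {S} {s} Real.0ℝ (λ h → h) lub 0<s
      ...   | q , q∈S , 0<q with em {P = 0𝕀 < q} | ub q q∈S
      ...     | yes _  | b≤u = b≤u
      ...     | no 0≮q | _   = ⊥-elim (0≮q 0<q)

    -- The reversed order turns the join into the meet of `b` and `¬ b`, while `constᵤ B 1𝕀` is `⊥`
    -- throughout because no point exceeds 1.
    indicator-∨ : ∀ b → _≈ᵤ_ B (_∨ᵤ_ B (indicator b) (indicator (B.¬ b))) (constᵤ B 1𝕀)
    indicator-∨ b q with em {P = 0𝕀 < q} | em {P = 1𝕀 < q}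
    ... | _     | yes 1<q = ⊥-elim (Real.<⇒≱ {val 1𝕀} {val q} 1<q (≤1 q))
    ... | no _  | no _    = B.antisym (B.x∧y≤x _ _) (B.minimum _)
    ... | yes _ | no _    = B.antisym
      -- In a Boolean algebra `x ⇨ y` unfolds to `¬ x ∨ y`, so the Heyting adjunction applies to
      -- `¬ b ≤ b ⇨ ⊥`.
      (B.trans (B.∧-greatest (B.x∧y≤y _ _) (B.x∧y≤x _ _)) (B.transpose-∧ (B.x≤x∨y _ _)))
      (B.minimum _)

    indicator-∧ : ∀ b → _≈ᵤ_ B (_∧ᵤ_ B (indicator b) (indicator (B.¬ b))) (constᵤ B 0𝕀)
    indicator-∧ b q with em {P = 0𝕀 < q}
    ... | no _  = B.antisym (B.∨-least B.refl B.refl) (B.minimum _)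
    ... | yes _ = B.antisym (B.maximum _)
      (B.trans (B.reflexive (B.Eq.sym ⇨-unit)) (B.∨-least (B.y≤x∨y _ _) (B.x≤x∨y _ _)))

    -- The indicator is to be thought of as the characteristic function of the region where `f` is
    -- at least `r`. Only `q > r` needs an argument, and there the claim reduces to
    -- `app f r ≤ app f q`.
    ≤-indicator-∨ : ∀ f r → _≤ᵤ_ B f (_∨ᵤ_ B (indicator (app f r)) (constᵤ B r))
    ≤-indicator-∨ f r q with em {P = 0𝕀 < q} | em {P = r < q}
    ... | no _  | _       = B.trans (B.x∧y≤x _ _) (B.minimum _)
    ... | yes _ | no _    = B.trans (B.x∧y≤y _ _) (B.minimum _)
    ... | yes _ | yes r<q = B.trans (B.x∧y≤x _ _)
      (app-mono B f (Real.<⇒≤ {val r} {val q} r<q))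

    -- Dually, for `0 < q ≤ r` the claim reduces to `app f q ≤ app f r`; at `q = 0` it needs
    -- `app f q` to be `⊥`.
    indicator-∧-≤ : ∀ f r → _≤ᵤ_ B (_∧ᵤ_ B (indicator (app f r)) (constᵤ B r)) f
    indicator-∧-≤ f r q with em {P = 0𝕀 < q} | em {P = r < q}
    ... | _      | yes _  = B.trans (B.maximum _) (B.y≤x∨y _ _)
    ... | no 0≮q | no _   = B.trans (app-≮0 f 0≮q) (B.minimum _)
    ... | yes _  | no r≮q = B.trans (app-mono B f q≤r) (B.x≤x∨y _ _)
      where
      q≤r : q ≤ r
      q≤r with em {P = q ≤ r}
      ... | yes h = h
      ... | no  h = ⊥-elim (r≮q (≰⇒> {val q} {val r} h))

    -- Transfer to C↗(X) along the isomorphism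

    module _ {ℓ : Level} (X : CompactOrderedSpace ℓ) (φ : X IsSpectrumOf USC B) where

      private
        module X = CompactOrderedSpace X
        open X using () renaming (Carrier to |X|)
        open _≅_ φ
        open Bijection bijection using (strictlySurjective) renaming (cong to to-cong)

      _∈⟦_⟧_ : ℚ → USCMap B → |X| → Set
      t ∈⟦ f ⟧ x = t ∈ cut (val (fun (to f) x))

      -- The isomorphism preserves joins, and joins determine the order.
      to-mono : ∀ {f h} → _≤ᵤ_ B f h → ∀ {x t} → t ∈⟦ f ⟧ x → t ∈⟦ h ⟧ x
      to-mono {f} {h} f≤h {x} t∈f = proj₁ (to-cong f∨h≈h x) (proj₂ (∨-homo f h x) (inj₁ t∈f))
        where
        f∨h≈h : _≈ᵤ_ B (_∨ᵤ_ B f h) h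
        f∨h≈h q = B.antisym (B.x∧y≤y _ _) (B.∧-greatest (f≤h q) B.refl)

      -- The images of indicator b and indicator (¬ b) are monotone and complementary.
      indicator-invariant : ∀ b {x y t} → x X.≤ y → 0ℚ ℚ.≤ t → t ℚ.< 1ℚ →
                            t ∈⟦ indicator b ⟧ y → t ∈⟦ indicator b ⟧ x
      indicator-invariant b {x} {y} {t} x≤y 0≤t t<1 t∈y
        with proj₁ (∨-homo (indicator b) (indicator (B.¬ b)) x)
               (proj₂ (to-cong (indicator-∨ b) x) (proj₂ (const-homo 1𝕀 x) t<1))
      ... | inj₁ t∈x  = t∈x
      ... | inj₂ t∈¬x = ⊥-elim (ℚ.<-irrefl refl (ℚ.<-≤-trans t<0 0≤t))
        where
        t<0 : t ℚ.< 0ℚ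
        t<0 = proj₁ (const-homo 0𝕀 y) (proj₁ (to-cong (indicator-∧ b) y)
          (proj₂ (∧-homo (indicator b) (indicator (B.¬ b)) y)
            (t∈y , monotone (to (indicator (B.¬ b))) x≤y t∈¬x)))

      -- If `r` is below `f` at `y`, it is below `h ∨ r` there, hence below `h` at `y` and, by
      -- invariance, at `x`. So every `t < r` is below `h ∧ r`, and therefore below `f`, at `x`.
      to-antitone : ∀ f {x y} → x X.≤ y → ∀ {t} → t ∈⟦ f ⟧ y → t ∈⟦ f ⟧ x
      to-antitone f {x} {y} x≤y {t} t∈y with t ℚ.<? 0ℚ
      ... | yes t<0 = nonNeg (fun (to f) x) t<0
      ... | no  t≮0 with rounded (val (fun (to f) y)) t∈y
      -- `r` is taken strictly above `t` because the cut of the constant `r` contains `t` but not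
      -- `r` itself.
      ...   | r , t<r , r∈y = to-mono (indicator-∧-≤ f r𝕀)
                (proj₂ (∧-homo h (constᵤ B r𝕀) x)
                  ( downward (val (fun (to h) x)) t<r
                      (indicator-invariant (app f r𝕀) x≤y 0≤r r<1 r∈h)
                  , proj₂ (const-homo r𝕀 x) t<r ))
        where
        0≤r : 0ℚ ℚ.≤ r
        0≤r = ℚ.≤-trans (ℚ.≮⇒≥ t≮0) (ℚ.<⇒≤ t<r)
        r<1 : r ℚ.< 1ℚ
        r<1 = ≤1 (fun (to f) y) r∈y
        r𝕀 : 𝕀
        r𝕀 = mk𝕀 (Real.fromℚ r) (λ q<0 → ℚ.<-≤-trans q<0 0≤r) (λ q<r → ℚ.<-trans q<r r<1)
        h : USCMap B
        h = indicator (app f r𝕀)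
        r∈h : r ∈⟦ h ⟧ y
        r∈h with proj₁ (∨-homo h (constᵤ B r𝕀) y) (to-mono (≤-indicator-∨ f r𝕀) r∈y)
        ... | inj₁ r∈h = r∈h
        ... | inj₂ r∈c = ⊥-elim (ℚ.<-irrefl refl (proj₁ (const-homo r𝕀 y) r∈c))

      C↗-antitone : ∀ (g : C↗Map X) {x y} → x X.≤ y → fun g y Interval.≤ fun g x
      C↗-antitone g {x} {y} x≤y t∈y =
        let f , f≈g = strictlySurjective g in
        proj₁ (f≈g x) (to-antitone f x≤y (proj₂ (f≈g y) t∈y))

corollary7p1p9 : (em : ∀ {ℓ} → ExcludedMiddle ℓ) → let open Classical em in
    ∀ {c ℓ₁ ℓ₂ ℓ} (B : CompleteBooleanAlgebra c ℓ₁ ℓ₂) (X : CompactOrderedSpace ℓ) →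
    X IsSpectrumOf USC B → let open CompactOrderedSpace X in
    ∀ x y → x ≤ y ⇔ x ≈ y
corollary7p1p9 em B X φ x y = mk⇔
  (λ x≤y → antisym x≤y (C↗-reflects-≤ X λ g → C↗-antitone B X φ g x≤y))
  reflexive
  where
  open Spectrum em
  open CompactOrderedSpace X
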